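{- Let $p$ be a prime, $q=p^k$, $n,d\ge1$, and write $d+1=s(q-q/p)+r$ with $s$ divisible by $p$ and $0<r\le p(q-q/p)$; let $t=\max(p+2,10)$. A function $f\colon\mathbb{F}_q^n\to\mathbb{F}_q$ passes the sparse $(s+t)$-flat test with probability $1$ (i.e. $\langle f\circ T,H_e\rangle=0$ for every affine $T\colon\mathbb{F}_q^{s+t}\to\mathbb{F}_q^n$ and every valid $e$) if and only if $f$ has degree at most $d$.
   Context: Functions $\mathbb{F}_q^m\to\mathbb{F}_q$ are identified with polynomials of individual degree $\le q-1$; degree means total degree. $\langle f,g\rangle=\sum_{v\in\mathbb{F}_q^m}f(v)g(v)$. For $x=(x_1,\dots,x_p)$ and $I\subseteq\{1,\dots,p\}$ write $x_I=\sum_{i\in I}x_i$. Let $P(x_1,\dots,x_p)$ be the polynomial $\big(\sum_{I\subseteq[p-1]}(-1)^{|I|+1}(x_I+x_p)^{q-1}\big)/(x_1\cdots x_{p-1})$ (the division is exact). For $e\in\{0,\dots,q-1\}^t$ let $H_e(x_1,\dots,x_{s+t})=\prod_{i=1}^{s/p}P(x_{p(i-1)+1},\dots,x_{pi})\cdot\prod_{i=1}^t x_{s+i}^{e_i}$. A vector $e\in\{0,\dots,q-1\}^t$ is valid if $\sum_{i=1}^t e_i\le t(q-1)-r$. The sparse $(s+t)$-flat test picks a uniformly random affine map $T\colon\mathbb{F}_q^{s+t}\to\mathbb{F}_q^n$ and accepts iff $\langle f\circ T,H_e\rangle=0$ for all valid $e$. -}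

module Defs where

open import Level using (0ℓ)
open import Data.Nat as ℕ using (ℕ; zero; suc; _≤_)
import Data.Bool
open import Data.Bool using (Bool; true; false; if_then_else_)
open import Data.Product using (_×_; _,_; ∃)
open import Data.List as List using (List; []; _∷_; _++_; concatMap; length)
open import Data.List.Membership.Propositional using (_∈_)
open import Data.List.Relation.Unary.Unique.Propositional using (Unique)
open import Data.Vec as Vec using (Vec; []; _∷_; splitAt; tabulate; zipWith; replicate)
open import Data.Fin as Fin using (Fin; fromℕ; inject₁)
import Data.Fin.Properties as FinP
open import Data.Fin.Subset using (Subset; ∣_∣)
import Data.Vec.Properties as VecP
import Data.Nat.Properties as ℕP
open import Relation.Nullary using (¬_; Dec; yes; no)
open import Relation.Nullary.Decidable using (⌊_⌋)
open import Data.Empty using (⊥)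
open import Data.List.Relation.Unary.All as All using (All)
open import Function using (_∘_)
open import Relation.Binary.PropositionalEquality using (_≡_)
open import Algebra.Structures using (IsCommutativeRing)

record FiniteField (q : ℕ) : Set₁ where
  infixl 7 _*_
  infixl 6 _+_
  field
    Carrier : Set
    _+_ _*_ : Carrier → Carrier → Carrier
    -_      : Carrier → Carrier
    0# 1#   : Carrier
    isCommutativeRing : IsCommutativeRing _≡_ _+_ _*_ -_ 0# 1#
    0≢1     : ¬ (0# ≡ 1#)
    inverse : ∀ x → ¬ (x ≡ 0#) → ∃ λ y → x * y ≡ 1#
    elements : List Carrier
    complete : ∀ x → x ∈ elements
    unique   : Unique elements
    size     : length elements ≡ q

allVecs : ∀ {X : Set} → List X → (m : ℕ) → List (Vec X m)
allVecs xs zero    = [] ∷ []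
allVecs xs (suc m) = concatMap (λ x → List.map (x ∷_) (allVecs xs m)) xs

module _ {q : ℕ} (F : FiniteField q) where
  open FiniteField F

  A = Carrier

  sumF : List A → A
  sumF = List.foldr _+_ 0#

  _^F_ : A → ℕ → A
  x ^F zero  = 1#
  x ^F suc n = x * (x ^F n)

  prodV : ∀ {m} → Vec A m → A
  prodV = Vec.foldr _ _*_ 1#

  points : (m : ℕ) → List (Vec A m)
  points m = allVecs elements m

  ⟨_,_⟩ : ∀ {m} → (Vec A m → A) → (Vec A m → A) → A
  ⟨_,_⟩ {m} g h = sumF (List.map (λ v → g v * h v) (points m))

  -- Formal polynomials in m variables: finite lists of terms
  -- (coefficient, exponent vector).  Repeated exponents are allowed;
  -- the coefficient of a monomial is the sum over matching terms.

  Poly : ℕ → Set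
  Poly m = List (A × Vec ℕ m)

  monomialValue : ∀ {m} → Vec ℕ m → Vec A m → A
  monomialValue a x = prodV (zipWith _^F_ x a)

  eval : ∀ {m} → Poly m → Vec A m → A
  eval P x = sumF (List.map (λ { (c , a) → c * monomialValue a x }) P)

  coeff : ∀ {m} → Poly m → Vec ℕ m → A
  coeff P a = sumF (List.map (λ { (c , b) → match c b }) P)
    where
    match : A → Vec ℕ _ → A
    match c b with VecP.≡-dec ℕP._≟_ b a
    ... | yes _ = c
    ... | no  _ = 0#

  _≐_ : ∀ {m} → Poly m → Poly m → Set
  P ≐ Q = ∀ a → coeff P a ≡ coeff Q a

  mulPoly : ∀ {m} → Poly m → Poly m → Poly m
  mulPoly P Q = concatMap (λ { (c , a) → List.map (λ { (c' , b) → (c * c' , zipWith ℕ._+_ a b) }) Q }) P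

  onePoly : ∀ {m} → Poly m
  onePoly = (1# , replicate _ 0) ∷ []

  powPoly : ∀ {m} → Poly m → ℕ → Poly m
  powPoly P zero    = onePoly
  powPoly P (suc n) = mulPoly P (powPoly P n)

  unitExp : ∀ {m} → Fin m → Vec ℕ m
  unitExp i = tabulate (λ j → if ⌊ i Fin.≟ j ⌋ then 1 else 0)

  -- The polynomial P(x_1,...,x_p).  We write p = suc p'; the variables
  -- x_1..x_{p-1} are the indices inject₁ i (i : Fin p'), and x_p is fromℕ p'.

  linPoly : (p' : ℕ) → Subset p' → Poly (suc p')
  linPoly p' I =
    List.map (λ i → (1# , unitExp (inject₁ i)))
             (List.filter (λ i → Vec.lookup I i Data.Bool.≟ true) (List.allFin p'))
    ++ ((1# , unitExp (fromℕ p')) ∷ [])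

  scalePoly : ∀ {m} → A → Poly m → Poly m
  scalePoly c = List.map (λ { (c' , a) → (c * c' , a) })

  Qpoly : (p' : ℕ) → Poly (suc p')
  Qpoly p' = concatMap (λ I → scalePoly ((- 1#) ^F (∣ I ∣ ℕ.+ 1)) (powPoly (linPoly p' I) (q ℕ.∸ 1)))
                       (allVecs (true ∷ false ∷ []) p')

  divExp : (p' : ℕ) → Vec ℕ (suc p')
  divExp zero     = 0 ∷ []
  divExp (suc p') = 1 ∷ divExp p'

  IsP : (p : ℕ) → Poly p → Set
  IsP zero     P = ⊥
  IsP (suc p') P = mulPoly ((1# , divExp p') ∷ []) P ≐ Qpoly p'

  -- H_e(x_1..x_{s+t}) with s = m·p  (m = s/p)

  blocksP : (p m : ℕ) → Poly p → Vec A (m ℕ.* p) → A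
  blocksP p zero    P x = 1#
  blocksP p (suc m) P x with splitAt p x
  ... | y , z , _ = eval P y * blocksP p m P z

  H : (p m t : ℕ) → Poly p → Vec ℕ t → Vec A (m ℕ.* p ℕ.+ t) → A
  H p m t P e x with splitAt (m ℕ.* p) x
  ... | u , w , _ = blocksP p m P u * prodV (zipWith _^F_ w e)

  -- e ∈ {0..q-1}^t is valid iff Σ e_i ≤ t(q-1) - r  (i.e. Σ e_i + r ≤ t(q-1))
  Valid : (t r : ℕ) → Vec ℕ t → Set
  Valid t r e = All (λ ei → ei ≤ q ℕ.∸ 1) (Vec.toList e) × (Vec.sum e ℕ.+ r ≤ t ℕ.* (q ℕ.∸ 1))

  affine : ∀ {a n} → Vec (Vec A a) n → Vec A n → Vec A a → Vec A n
  affine M b y = zipWith (λ row bi → sumF (Vec.toList (zipWith _*_ row y)) + bi) M b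

  PassesSparseFlatTest : ∀ {n} (p m t r : ℕ) → Poly p → (Vec A n → A) → Set
  PassesSparseFlatTest {n} p m t r P f =
    ∀ (M : Vec (Vec A (m ℕ.* p ℕ.+ t)) n) (b : Vec A n) (e : Vec ℕ t) →
    Valid t r e → ⟨ f ∘ affine M b , H p m t P e ⟩ ≡ 0#

  DegreeAtMost : ∀ {n} → (Vec A n → A) → ℕ → Set
  DegreeAtMost {n} f d =
    ∃ λ (R : Poly n) →
      All (λ { (c , a) → All (λ ai → ai ≤ q ℕ.∸ 1) (Vec.toList a) × Vec.sum a ≤ d }) R
      × (∀ v → f v ≡ eval R v)

-- Write β = q/p and γ = q − β = (p − 1)β. A polynomial in N variables of total degree below N(q − 1) has sum zero
-- over F^N, because Σ x^i = 0 for i < q − 1. As P is homogeneous of degree q − p, the degrees of f ∘ T and H_e add up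
-- to less than N(q − 1) if f has degree at most d, which is one direction.
--
-- For the other one, the functions on F^(s+t) that are orthogonal to all H_e form a subspace. Substituting λσ for an
-- affine form σ, or σ + λτ, gives polynomials in λ with values in this subspace, whose coefficients then lie in it as
-- well. In this way a passing f with a monomial of degree w > d puts products of powers τ^(p^u), for arbitrary affine
-- forms τ and with Σ p^u = w, into the subspace. Taken in descending order, the p^u fill successive bins of capacity
-- γ exactly, so that identifying the forms τ of each bin with one coordinate yields a monomial x_1^γ ⋯ x_s^γ y^b with
-- Σ b ≥ r. It is not orthogonal to H_e for e = q − 1 − b: the product factors over the coordinates, and on a block
--   Σ_x x_1^γ ⋯ x_p^γ P(x) = ± Σ_x (x_1 ⋯ x_(p−1))^(γ−1) (x_1 + ⋯ + x_(p−1))^γ = ± (p − 1)!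
-- by (x_1 + ⋯ + x_(p−1))^β = x_1^β + ⋯ + x_(p−1)^β.
module Submission where

open import Defs
open import Data.Nat using (ℕ; _+_; _*_; _∸_; _^_; _≤_; _<_; _⊔_)
open import Data.Nat.Primality using (Prime)
open import Data.Vec using (Vec)
open import Relation.Binary.PropositionalEquality using (_≡_)
open import Function.Bundles using (_⇔_)

import Data.Nat.Properties as ℕ
open import Data.Nat.Properties using (_!*_!≢0)
open import Algebra.Bundles using (CommutativeRing)
open import Algebra.Properties.CommutativeSemigroup ℕ.+-commutativeSemigroup using () renaming (interchange to +-interchange)
open import Data.Bool as Bool using (Bool; true; false; if_then_else_)
open import Data.Empty using (⊥; ⊥-elim)
open import Data.Fin as Fin using (Fin; zero; suc; toℕ; fromℕ; inject₁)
import Data.Fin.Properties as Fin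
open import Data.Fin.Subset using (Subset; ∣_∣)
open import Data.List as List using (List; []; _∷_; map; concatMap; length; _++_; filter)
import Data.List.Properties as List
open import Data.List.Membership.Propositional using (_∈_)
open import Data.List.Membership.Propositional.Properties using (∈-map⁺; ∈-map⁻)
open import Data.List.Membership.Propositional.Properties.WithK using (unique∧set⇒bag)
open import Data.List.Relation.Binary.BagAndSetEquality using (∼bag⇒↭)
open import Data.List.Relation.Binary.Permutation.Propositional as Perm using (_↭_; prep; swap; ↭-sym)
open import Data.List.Relation.Binary.Permutation.Propositional.Properties using (↭-map-inv; All-resp-↭)
open import Data.List.Relation.Unary.All as All using (All; []; _∷_)
import Data.List.Relation.Unary.All.Properties as All
open import Data.List.Relation.Unary.AllPairs using (AllPairs; []; _∷_)
open import Data.List.Relation.Unary.Any using (here; there; index)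
open import Data.List.Relation.Unary.Any.Properties using (lookup-index)
open import Data.List.Relation.Unary.Linked.Properties using (Linked⇒AllPairs)
open import Data.List.Relation.Unary.Unique.Propositional using (Unique)
import Data.List.Relation.Unary.Unique.Propositional.Properties as Unique
import Data.List.Sort as Sort
open import Data.Nat using (zero; suc; pred; _⊓_; _≥_; _!; z≤n; s≤s; NonZero; >-nonZero; >-nonZero⁻¹; nonTrivial⇒n>1)
open import Data.Nat.Combinatorics using (_C_; nCn≡1; nC1≡n; nCk≡n!/k![n-k]!; k![n∸k]!∣n!)
open import Data.Nat.Coprimality using (Coprime; coprime-Bézout)
open import Data.Nat.Divisibility using (_∣_; divides; _∣?_; ∣⇒≤; ∣m+n∣m⇒∣n; ∣n⇒∣m*n)
import Data.Nat.DivMod as DivMod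
open import Data.Nat.GCD using (module Bézout)
open import Data.Nat.Induction using (<-wellFounded)
open import Data.Nat.Primality using (prime⇒irreducible; prime⇒nonZero; prime⇒nonTrivial)
open import Data.Product using (∃; ∃₂; _×_; _,_; proj₁; proj₂)
open import Data.Sum using (inj₁; inj₂; [_,_]′)
open import Data.Unit using (⊤; tt)
open import Data.Vec as Vec using ([]; _∷_)
import Data.Vec.Properties as Vec
open import Data.Vec.Relation.Unary.All as VAll using ([]; _∷_) renaming (All to VAll)
open import Function using (_∘_; id)
open import Function.Bundles using (mk⇔)
open import Induction.WellFounded using (Acc; acc)
open import Level using (0ℓ)
import Relation.Binary.Construct.Flip.EqAndOrd as Flip
open import Relation.Binary.PropositionalEquality
open import Relation.Nullary using (¬_; Dec; yes; no; ¬?)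
open import Relation.Nullary.Decidable using (⌊_⌋; map′; decidable-stable)

-- Polarisation is limited by the characteristic. Extracting a independent linear factors from σ^a
-- costs the coefficient a!, which is zero in F for a ≥ p, and τ^(p^u), being additive in τ, does
-- not split any further. So the pieces to be distributed are p^u-th powers with u < k, and a bin
-- can be filled exactly by any of them if its capacity is a multiple of p^(k-1). The largest such
-- number below q is γ = (p - 1)p^(k-1), which is the origin of q - q/p. Weight beyond the total
-- capacity of all s + t bins does no harm: a form that finds no bin is replaced by the constant 1.
--
-- No single monomial of f is ever selected. The variables are eliminated one after the other, and
-- each coefficient function inherits the duty to pass, multiplied by the powers already split off;
-- the bound on the degree appears when only constants are left.

-- Arithmetic and finite sums in a finite field.

module Field {q : ℕ} (F : FiniteField q) where
  open FiniteField F public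
    renaming (_+_ to infixl 6 _⊕_; _*_ to infixl 7 _⊗_; -_ to infix 9 ⊖_; 0# to 𝟘; 1# to 𝟙)
  open ≡-Reasoning

  ring : CommutativeRing 0ℓ 0ℓ
  ring = record { isCommutativeRing = isCommutativeRing }

  open CommutativeRing ring public using
    ( +-identityˡ; +-identityʳ; +-assoc; +-comm; *-identityˡ; *-identityʳ; *-assoc; *-comm
    ; distribˡ; distribʳ; zeroˡ; zeroʳ; -‿inverseˡ; -‿inverseʳ; commutativeSemiring; semiring)
  open import Algebra.Properties.Ring (CommutativeRing.ring ring) public
    using (-1*x≈-x; -‿involutive; -0#≈0#; +-cancelˡ; +-cancelʳ)
  open import Algebra.Solver.Ring.NaturalCoefficients.Default commutativeSemiring public
    using (solve; _:=_; _:+_; _:*_; con)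

  infixr 8 _↑_
  _↑_ : Carrier → ℕ → Carrier
  x ↑ n = _^F_ F x n

  infix 4 _≟_
  _≟_ : (x y : Carrier) → Dec (x ≡ y)
  x ≟ y = map′ same (cong (index ∘ complete)) (index (complete x) Fin.≟ index (complete y))
    where
    same : index (complete x) ≡ index (complete y) → x ≡ y
    same e = trans (lookup-index (complete x))
             (trans (cong (List.lookup elements) e) (sym (lookup-index (complete y))))

  *-cancelˡ : ∀ x {y z} → ¬ x ≡ 𝟘 → x ⊗ y ≡ x ⊗ z → y ≡ z
  *-cancelˡ x {y} {z} x≢0 e with inverse x x≢0
  ... | i , xi≡1 = begin
    y            ≡⟨ cancel y ⟨
    i ⊗ (x ⊗ y)  ≡⟨ cong (i ⊗_) e ⟩
    i ⊗ (x ⊗ z)  ≡⟨ cancel z ⟩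
    z            ∎
    where
    cancel : ∀ w → i ⊗ (x ⊗ w) ≡ w
    cancel w = trans (sym (*-assoc i x w))
               (trans (cong (_⊗ w) (trans (*-comm i x) xi≡1)) (*-identityˡ w))

  *-nonzero : ∀ {x y} → ¬ x ≡ 𝟘 → ¬ y ≡ 𝟘 → ¬ x ⊗ y ≡ 𝟘
  *-nonzero {x} x≢0 y≢0 e = y≢0 (*-cancelˡ x x≢0 (trans e (sym (zeroʳ x))))

  inv : Carrier → Carrier
  inv x with x ≟ 𝟘
  ... | yes _  = 𝟘
  ... | no x≢0 = proj₁ (inverse x x≢0)

  inv-inverse : ∀ {x} → ¬ x ≡ 𝟘 → x ⊗ inv x ≡ 𝟙
  inv-inverse {x} x≢0 with x ≟ 𝟘
  ... | yes x≡0 = ⊥-elim (x≢0 x≡0)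
  ... | no x≢0′ = proj₂ (inverse x x≢0′)

  ↑-nonzero : ∀ {x} n → ¬ x ≡ 𝟘 → ¬ x ↑ n ≡ 𝟘
  ↑-nonzero zero    x≢0 e = 0≢1 (sym e)
  ↑-nonzero (suc n) x≢0   = *-nonzero x≢0 (↑-nonzero n x≢0)

  ⊖-nonzero : ∀ {x} → ¬ x ≡ 𝟘 → ¬ ⊖ x ≡ 𝟘
  ⊖-nonzero {x} x≢0 e = x≢0 (trans (sym (-‿involutive x)) (trans (cong ⊖_ e) -0#≈0#))

  ↑-+ : ∀ x m n → x ↑ (m + n) ≡ x ↑ m ⊗ x ↑ n
  ↑-+ x zero    n = sym (*-identityˡ _)
  ↑-+ x (suc m) n = trans (cong (x ⊗_) (↑-+ x m n)) (sym (*-assoc _ _ _))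

  ↑-* : ∀ x m n → x ↑ (n * m) ≡ (x ↑ m) ↑ n
  ↑-* x m zero    = refl
  ↑-* x m (suc n) = trans (↑-+ x m (n * m)) (cong (x ↑ m ⊗_) (↑-* x m n))

  *-↑ : ∀ x y n → (x ⊗ y) ↑ n ≡ x ↑ n ⊗ y ↑ n
  *-↑ x y zero    = sym (*-identityˡ _)
  *-↑ x y (suc n) = trans (cong (x ⊗ y ⊗_) (*-↑ x y n))
    (solve 4 (λ a b c d → a :* b :* (c :* d) := a :* c :* (b :* d)) refl x y (x ↑ n) (y ↑ n))

  𝟙-↑ : ∀ n → 𝟙 ↑ n ≡ 𝟙
  𝟙-↑ zero    = refl
  𝟙-↑ (suc n) = trans (*-identityˡ _) (𝟙-↑ n)

  𝟘-↑ : ∀ {n} → 0 < n → 𝟘 ↑ n ≡ 𝟘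
  𝟘-↑ {suc n} _ = zeroˡ _

  x-y≡0⇒x≡y : ∀ {x y} → x ⊕ ⊖ y ≡ 𝟘 → x ≡ y
  x-y≡0⇒x≡y {x} {y} e = +-cancelʳ (⊖ y) x y (trans e (sym (-‿inverseʳ y)))

  y+[x-y]≡x : ∀ x y → y ⊕ (x ⊕ ⊖ y) ≡ x
  y+[x-y]≡x x y = begin
    y ⊕ (x ⊕ ⊖ y)  ≡⟨ solve 3 (λ x y z → y :+ (x :+ z) := x :+ (y :+ z)) refl x y (⊖ y) ⟩
    x ⊕ (y ⊕ ⊖ y)  ≡⟨ cong (x ⊕_) (-‿inverseʳ y) ⟩
    x ⊕ 𝟘          ≡⟨ +-identityʳ x ⟩
    x              ∎

  -- Finite sums

  ∑ : ∀ {X : Set} → List X → (X → Carrier) → Carrier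
  ∑ xs f = sumF F (map f xs)

  module _ {X : Set} where
    ∑-cong : ∀ (xs : List X) {f g : X → Carrier} → (∀ x → f x ≡ g x) → ∑ xs f ≡ ∑ xs g
    ∑-cong xs e = cong (sumF F) (List.map-cong e xs)

    ∑-++ : ∀ (xs ys : List X) f → ∑ (xs ++ ys) f ≡ ∑ xs f ⊕ ∑ ys f
    ∑-++ []       ys f = sym (+-identityˡ _)
    ∑-++ (x ∷ xs) ys f = trans (cong (f x ⊕_) (∑-++ xs ys f)) (sym (+-assoc _ _ _))

    ∑-zero : ∀ (xs : List X) → ∑ xs (λ _ → 𝟘) ≡ 𝟘
    ∑-zero []       = refl
    ∑-zero (x ∷ xs) = trans (+-identityˡ _) (∑-zero xs)

    ∑-+ : ∀ (xs : List X) f g → ∑ xs (λ x → f x ⊕ g x) ≡ ∑ xs f ⊕ ∑ xs g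
    ∑-+ []       f g = sym (+-identityˡ _)
    ∑-+ (x ∷ xs) f g = trans (cong (f x ⊕ g x ⊕_) (∑-+ xs f g))
      (solve 4 (λ a b c d → a :+ b :+ (c :+ d) := a :+ c :+ (b :+ d)) refl (f x) (g x) (∑ xs f) (∑ xs g))

    ∑-*ˡ : ∀ (xs : List X) c f → ∑ xs (λ x → c ⊗ f x) ≡ c ⊗ ∑ xs f
    ∑-*ˡ []       c f = sym (zeroʳ c)
    ∑-*ˡ (x ∷ xs) c f = trans (cong (c ⊗ f x ⊕_) (∑-*ˡ xs c f)) (sym (distribˡ _ _ _))

    ∑-*ʳ : ∀ (xs : List X) c f → ∑ xs (λ x → f x ⊗ c) ≡ ∑ xs f ⊗ c
    ∑-*ʳ xs c f = trans (∑-cong xs (λ x → *-comm (f x) c)) (trans (∑-*ˡ xs c f) (*-comm c _))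

    ∑-map : ∀ {Y : Set} (h : Y → X) ys f → ∑ (map h ys) f ≡ ∑ ys (f ∘ h)
    ∑-map h ys f = cong (sumF F) (sym (List.map-∘ ys))

    ∑-concatMap : ∀ {Y : Set} (h : Y → List X) ys f → ∑ (concatMap h ys) f ≡ ∑ ys (λ y → ∑ (h y) f)
    ∑-concatMap h []       f = refl
    ∑-concatMap h (y ∷ ys) f = trans (∑-++ (h y) (concatMap h ys) f) (cong (∑ (h y) f ⊕_) (∑-concatMap h ys f))

    ∑-↭ : ∀ {xs ys : List X} f → xs ↭ ys → ∑ xs f ≡ ∑ ys f
    ∑-↭ f Perm.refl          = refl
    ∑-↭ f (prep x p)         = cong (f x ⊕_) (∑-↭ f p)
    ∑-↭ f (swap {xs} {ys} x y p) = trans (cong (λ s → f x ⊕ (f y ⊕ s)) (∑-↭ f p))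
      (solve 3 (λ a b c → a :+ (b :+ c) := b :+ (a :+ c)) refl (f x) (f y) (∑ ys f))
    ∑-↭ f (Perm.trans p₁ p₂) = trans (∑-↭ f p₁) (∑-↭ f p₂)

  ∑-comm : ∀ {X Y : Set} (xs : List X) (ys : List Y) (f : X → Y → Carrier) →
           ∑ xs (λ x → ∑ ys (f x)) ≡ ∑ ys (λ y → ∑ xs (λ x → f x y))
  ∑-comm []       ys f = sym (∑-zero ys)
  ∑-comm (x ∷ xs) ys f = trans (cong (∑ ys (f x) ⊕_) (∑-comm xs ys f)) (sym (∑-+ ys (f x) _))

  permutes : ∀ (h : Carrier → Carrier) → (∀ {x y} → h x ≡ h y → x ≡ y) → (∀ y → ∃ λ x → y ≡ h x) →
             map h elements ↭ elements
  permutes h inj surj = ∼bag⇒↭ (unique∧set⇒bag (Unique.map⁺ inj unique) unique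
    (λ {y} → mk⇔ (λ _ → complete y) (λ _ → subst (_∈ map h elements) (sym (proj₂ (surj y))) (∈-map⁺ h (complete (proj₁ (surj y)))))))

  ∑-permute : ∀ (h : Carrier → Carrier) → (∀ {x y} → h x ≡ h y → x ≡ y) → (∀ y → ∃ λ x → y ≡ h x) →
              ∀ f → ∑ elements (f ∘ h) ≡ ∑ elements f
  ∑-permute h inj surj f = trans (sym (∑-map h elements f)) (∑-↭ f (permutes h inj surj))

  ∑-shift : ∀ c f → ∑ elements (λ x → f (c ⊕ x)) ≡ ∑ elements f
  ∑-shift c f = ∑-permute (c ⊕_) (+-cancelˡ c _ _) (λ y → y ⊕ ⊖ c , sym (y+[x-y]≡x y c)) f

  ∑-scale : ∀ c → ¬ c ≡ 𝟘 → ∀ f → ∑ elements (λ x → f (c ⊗ x)) ≡ ∑ elements f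
  ∑-scale c c≢0 = ∑-permute (c ⊗_) (*-cancelˡ c c≢0)
    (λ y → proj₁ (inverse c c≢0) ⊗ y ,
      sym (trans (sym (*-assoc c _ y)) (trans (cong (_⊗ y) (proj₂ (inverse c c≢0))) (*-identityˡ y))))

  -- Integers in the field

  nat : ℕ → Carrier
  nat zero    = 𝟘
  nat (suc n) = 𝟙 ⊕ nat n

  nat-+ : ∀ m n → nat (m + n) ≡ nat m ⊕ nat n
  nat-+ zero    n = sym (+-identityˡ _)
  nat-+ (suc m) n = trans (cong (𝟙 ⊕_) (nat-+ m n)) (sym (+-assoc _ _ _))

  nat-* : ∀ m n → nat (m * n) ≡ nat m ⊗ nat n
  nat-* zero    n = sym (zeroˡ _)
  nat-* (suc m) n = begin
    nat (n + m * n)              ≡⟨ nat-+ n (m * n) ⟩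
    nat n ⊕ nat (m * n)          ≡⟨ cong (nat n ⊕_) (nat-* m n) ⟩
    nat n ⊕ nat m ⊗ nat n        ≡⟨ solve 2 (λ x y → y :+ x :* y := (con 1 :+ x) :* y) refl (nat m) (nat n) ⟩
    (𝟙 ⊕ nat m) ⊗ nat n          ∎

  nat-^ : ∀ m n → nat (m ^ n) ≡ nat m ↑ n
  nat-^ m zero    = +-identityʳ 𝟙
  nat-^ m (suc n) = trans (nat-* m (m ^ n)) (cong (nat m ⊗_) (nat-^ m n))

  ∑-const : ∀ {X : Set} (xs : List X) c → ∑ xs (λ _ → c) ≡ nat (length xs) ⊗ c
  ∑-const []       c = sym (zeroˡ c)
  ∑-const (x ∷ xs) c = trans (cong (c ⊕_) (∑-const xs c))
    (solve 2 (λ x y → y :+ x :* y := (con 1 :+ x) :* y) refl (nat (length xs)) c)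

  -- Translation by 1 permutes the field, so the sum `T` of all elements equals `nat q ⊕ T`.
  nat-q≡0 : nat q ≡ 𝟘
  nat-q≡0 = +-cancelʳ T (nat q) 𝟘 (begin
    nat q ⊕ T                                        ≡⟨ cong (_⊕ T) (trans (cong nat (sym size)) (sym (*-identityʳ _))) ⟩
    nat (length elements) ⊗ 𝟙 ⊕ T                    ≡⟨ cong (_⊕ T) (∑-const elements 𝟙) ⟨
    ∑ elements (λ _ → 𝟙) ⊕ T                         ≡⟨ ∑-+ elements (λ _ → 𝟙) (λ x → x) ⟨
    ∑ elements (𝟙 ⊕_)                                ≡⟨ ∑-shift 𝟙 (λ x → x) ⟩
    T                                                ≡⟨ +-identityˡ T ⟨
    𝟘 ⊕ T                                            ∎)
    where T = ∑ elements (λ x → x)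

-- Polynomials whose coefficients are functions: division, extraction of coefficients,
-- interpolation.

module Interpolation {q : ℕ} (F : FiniteField q) where
  open Field F
  open ≡-Reasoning

  -- The field `ext` lets membership depend only on the values of a function, in place of function
  -- extensionality.
  record Subspace {W : Set} (V : (W → Carrier) → Set) : Set where
    field
      ext   : ∀ {g h} → (∀ w → g w ≡ h w) → V g → V h
      null  : V (λ _ → 𝟘)
      add   : ∀ {g h} → V g → V h → V (λ w → g w ⊕ h w)
      scale : ∀ c {g} → V g → V (λ w → c ⊗ g w)

    cancelʳ : ∀ {g h} → V h → V (λ w → g w ⊕ h w) → V g
    cancelʳ {g} {h} h∈V g+h∈V = ext minus (add g+h∈V (scale (⊖ 𝟙) h∈V))
      where
      minus : ∀ w → g w ⊕ h w ⊕ ⊖ 𝟙 ⊗ h w ≡ g w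
      minus w = begin
        g w ⊕ h w ⊕ ⊖ 𝟙 ⊗ h w  ≡⟨ cong (g w ⊕ h w ⊕_) (-1*x≈-x (h w)) ⟩
        g w ⊕ h w ⊕ ⊖ h w      ≡⟨ +-assoc (g w) (h w) (⊖ h w) ⟩
        g w ⊕ (h w ⊕ ⊖ h w)    ≡⟨ cong (g w ⊕_) (-‿inverseʳ (h w)) ⟩
        g w ⊕ 𝟘                ≡⟨ +-identityʳ (g w) ⟩
        g w                    ∎

    unscale : ∀ {c g} → ¬ c ≡ 𝟘 → V (λ w → c ⊗ g w) → V g
    unscale {c} {g} c≢0 cg∈V = ext
      (λ w → trans (sym (*-assoc _ c (g w))) (trans (cong (_⊗ g w) (trans (*-comm _ c) (proj₂ (inverse c c≢0)))) (*-identityˡ (g w))))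
      (scale (proj₁ (inverse c c≢0)) cg∈V)

  open Subspace

  module _ {W : Set} where
    -- A vector of functions on W is read as a polynomial over them, constant coefficient first.
    ev : ∀ {n} → Vec (W → Carrier) n → Carrier → W → Carrier
    ev []       μ w = 𝟘
    ev (v ∷ vs) μ w = v w ⊕ μ ⊗ ev vs μ w

    -- Synthetic division: the entries are the values at μ of the successive tails, as in Horner's
    -- rule. The quotient of `v ∷ vs` by λ - μ is `quot μ vs`; the constant coefficient v does not
    -- enter it.
    quot : ∀ {n} → Carrier → Vec (W → Carrier) n → Vec (W → Carrier) n
    quot μ []       = []
    quot μ (v ∷ vs) = ev (v ∷ vs) μ ∷ quot μ vs

    ev-quot : ∀ {n} μ δ v (vs : Vec (W → Carrier) n) w →
              ev (v ∷ vs) (μ ⊕ δ) w ≡ δ ⊗ ev (quot μ vs) (μ ⊕ δ) w ⊕ ev (v ∷ vs) μ w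
    ev-quot μ δ v [] w =
      solve 3 (λ m d a → a :+ (m :+ d) :* con 0 := d :* con 0 :+ (a :+ m :* con 0)) refl μ δ (v w)
    ev-quot μ δ v (u ∷ vs) w = begin
      v w ⊕ (μ ⊕ δ) ⊗ ev (u ∷ vs) (μ ⊕ δ) w   ≡⟨ cong (λ z → v w ⊕ (μ ⊕ δ) ⊗ z) (ev-quot μ δ u vs w) ⟩
      v w ⊕ (μ ⊕ δ) ⊗ (δ ⊗ Q ⊕ E)             ≡⟨ solve 5 (λ m d a x e → a :+ (m :+ d) :* (d :* x :+ e)
                                                    := d :* (e :+ (m :+ d) :* x) :+ (a :+ m :* e)) refl μ δ (v w) Q E ⟩
      δ ⊗ (E ⊕ (μ ⊕ δ) ⊗ Q) ⊕ (v w ⊕ μ ⊗ E)   ∎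
      where
      Q = ev (quot μ vs) (μ ⊕ δ) w
      E = ev (u ∷ vs) μ w

    module _ {V : (W → Carrier) → Set} (sub : Subspace V) where
      ev∈ : ∀ {n} {vs : Vec (W → Carrier) n} μ → VAll V vs → V (ev vs μ)
      ev∈ μ []       = null sub
      ev∈ μ (v ∷ vs) = add sub v (scale sub μ (ev∈ μ vs))

      -- Horner's rule run backwards: a coefficient is the value of its tail minus μ times the value
      -- of the next tail, and the latter is already known to lie in the subspace.
      unquot : ∀ {n} μ (vs : Vec (W → Carrier) n) → VAll V (quot μ vs) → VAll V vs
      unquot μ []       []           = []
      unquot μ (v ∷ vs) (v∈ ∷ quot∈) = cancelʳ sub (scale sub μ (ev∈ μ rest)) v∈ ∷ rest
        where rest = unquot μ vs quot∈

      -- By divided differences, as for Newton interpolation.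
      extract : ∀ {n} (ps : List Carrier) → Unique ps → n ≤ length ps → (vs : Vec (W → Carrier) n) →
                (∀ {μ} → μ ∈ ps → V (ev vs μ)) → VAll V vs
      extract ps _ _ [] _ = []
      extract (μ ∷ ps) (μ∉ps ∷ unique-ps) (s≤s n≤) (v ∷ vs) vals =
        cancelʳ sub (scale sub μ (ev∈ μ vs∈)) (vals (here refl)) ∷ vs∈
        where
        shifted : ∀ {ν} → ν ∈ ps → V (ev (quot μ vs) ν)
        shifted {ν} ν∈ps = unscale sub ν-μ≢0
          (cancelʳ sub (vals (here refl)) (ext sub moved (vals (there ν∈ps))))
          where
          ν-μ≢0 : ¬ ν ⊕ ⊖ μ ≡ 𝟘
          ν-μ≢0 e = All.lookup μ∉ps ν∈ps (sym (x-y≡0⇒x≡y e))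
          moved : ∀ w → ev (v ∷ vs) ν w ≡ (ν ⊕ ⊖ μ) ⊗ ev (quot μ vs) ν w ⊕ ev (v ∷ vs) μ w
          moved w = subst (λ z → ev (v ∷ vs) z w ≡ (ν ⊕ ⊖ μ) ⊗ ev (quot μ vs) z w ⊕ ev (v ∷ vs) μ w)
                          (y+[x-y]≡x ν μ) (ev-quot μ (ν ⊕ ⊖ μ) v vs w)
        vs∈ = unquot μ vs (extract ps unique-ps n≤ (quot μ vs) shifted)

    -- The argument c is the carry into the current coefficient. With y = -μ and z = 1 this
    -- assembles Newton's form of an interpolating polynomial; iterated with fixed y and z it
    -- expands powers of y + λz.
    mulLinear : ∀ {n} → (y z c : W → Carrier) → Vec (W → Carrier) n → Vec (W → Carrier) (suc n)
    mulLinear y z c []       = c ∷ []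
    mulLinear y z c (v ∷ vs) = (λ w → c w ⊕ y w ⊗ v w) ∷ mulLinear y z (λ w → z w ⊗ v w) vs

    ev-mulLinear : ∀ {n} y z c (vs : Vec (W → Carrier) n) μ w →
                   ev (mulLinear y z c vs) μ w ≡ c w ⊕ (y w ⊕ μ ⊗ z w) ⊗ ev vs μ w
    ev-mulLinear y z c [] μ w =
      solve 4 (λ y z c m → c :+ m :* con 0 := c :+ (y :+ m :* z) :* con 0) refl (y w) (z w) (c w) μ
    ev-mulLinear y z c (v ∷ vs) μ w = trans
      (cong (λ e → c w ⊕ y w ⊗ v w ⊕ μ ⊗ e) (ev-mulLinear y z (λ w → z w ⊗ v w) vs μ w))
      (solve 6 (λ y z c m v e → c :+ y :* v :+ m :* (z :* v :+ (y :+ m :* z) :* e)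
                := c :+ (y :+ m :* z) :* (v :+ m :* e)) refl (y w) (z w) (c w) μ (v w) (ev vs μ w))

    interpolate : ∀ (ps : List Carrier) → Unique ps → (f : Carrier → W → Carrier) →
                  ∃ λ (vs : Vec (W → Carrier) (length ps)) → ∀ {μ} → μ ∈ ps → ∀ w → f μ w ≡ ev vs μ w
    interpolate []       _ f = [] , λ ()
    interpolate (μ ∷ ps) (μ∉ps ∷ unique-ps) f = mulLinear (λ _ → ⊖ μ) (λ _ → 𝟙) (f μ) vs , agree
      where
      -- The divided difference of f at μ and ν. At ν = μ the default value of `inv` makes it zero,
      -- but it is interpolated only at the nodes of `ps`, which all differ from μ.
      slope : Carrier → W → Carrier
      slope ν w = inv (ν ⊕ ⊖ μ) ⊗ (f ν w ⊕ ⊖ f μ w)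
      vs = proj₁ (interpolate ps unique-ps slope)
      agree : ∀ {ν} → ν ∈ μ ∷ ps → ∀ w → f ν w ≡ ev (mulLinear (λ _ → ⊖ μ) (λ _ → 𝟙) (f μ) vs) ν w
      agree {ν} ν∈ w = sym (trans (ev-mulLinear (λ _ → ⊖ μ) (λ _ → 𝟙) (f μ) vs ν w) (value ν∈))
        where
        value : ν ∈ μ ∷ ps → f μ w ⊕ (⊖ μ ⊕ ν ⊗ 𝟙) ⊗ ev vs ν w ≡ f ν w
        value (here refl) = begin
          f μ w ⊕ (⊖ μ ⊕ ν ⊗ 𝟙) ⊗ ev vs ν w  ≡⟨ cong (λ z → f μ w ⊕ (⊖ μ ⊕ z) ⊗ ev vs ν w) (*-identityʳ ν) ⟩
          f μ w ⊕ (⊖ μ ⊕ ν) ⊗ ev vs ν w      ≡⟨ cong (λ z → f μ w ⊕ z ⊗ ev vs ν w) (-‿inverseˡ μ) ⟩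
          f μ w ⊕ 𝟘 ⊗ ev vs ν w              ≡⟨ cong (f μ w ⊕_) (zeroˡ _) ⟩
          f μ w ⊕ 𝟘                          ≡⟨ +-identityʳ _ ⟩
          f μ w                              ∎
        value (there ν∈ps) = begin
          f μ w ⊕ (⊖ μ ⊕ ν ⊗ 𝟙) ⊗ ev vs ν w        ≡⟨ cong (f μ w ⊕_) (cong₂ _⊗_
                                                       (trans (+-comm (⊖ μ) _) (cong (_⊕ ⊖ μ) (*-identityʳ ν)))
                                                       (sym (proj₂ (interpolate ps unique-ps slope) ν∈ps w))) ⟩
          f μ w ⊕ d ⊗ (inv d ⊗ (f ν w ⊕ ⊖ f μ w))  ≡⟨ cong (f μ w ⊕_) (trans (sym (*-assoc d _ _))
                                                       (trans (cong (_⊗ (f ν w ⊕ ⊖ f μ w)) (inv-inverse d≢0)) (*-identityˡ _))) ⟩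
          f μ w ⊕ (f ν w ⊕ ⊖ f μ w)                ≡⟨ y+[x-y]≡x (f ν w) (f μ w) ⟩
          f ν w                                    ∎
          where
          d = ν ⊕ ⊖ μ
          d≢0 : ¬ d ≡ 𝟘
          d≢0 e = All.lookup μ∉ps ν∈ps (sym (x-y≡0⇒x≡y e))

-- The sums of i-th powers over the field, and Fermat's theorem.

module PowerSums {q : ℕ} (F : FiniteField q) where
  open Field F
  open Interpolation F
  open ≡-Reasoning

  q≡1+[q-1] : q ≡ suc (q ∸ 1)
  q≡1+[q-1] = subst (λ n → n ≡ suc (n ∸ 1)) size (nonempty (complete 𝟘))
    where
    nonempty : ∀ {x : Carrier} {xs} → x ∈ xs → length xs ≡ suc (length xs ∸ 1)
    nonempty (here _)  = refl
    nonempty (there _) = refl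

  powerSum : ℕ → Carrier
  powerSum i = ∑ elements (_↑ i)

  powerSum-scale : ∀ i {a} → ¬ a ≡ 𝟘 → a ↑ i ⊗ powerSum i ≡ powerSum i
  powerSum-scale i {a} a≢0 = begin
    a ↑ i ⊗ powerSum i                     ≡⟨ ∑-*ˡ elements (a ↑ i) (_↑ i) ⟨
    ∑ elements (λ x → a ↑ i ⊗ x ↑ i)       ≡⟨ ∑-cong elements (λ x → *-↑ a x i) ⟨
    ∑ elements (λ x → (a ⊗ x) ↑ i)         ≡⟨ ∑-scale a a≢0 (_↑ i) ⟩
    powerSum i                             ∎

  powerSum≢0⇒↑≡1 : ∀ i → ¬ powerSum i ≡ 𝟘 → ∀ {a} → ¬ a ≡ 𝟘 → a ↑ i ≡ 𝟙
  powerSum≢0⇒↑≡1 i S≢0 {a} a≢0 = *-cancelˡ (powerSum i) S≢0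
    (trans (*-comm _ (a ↑ i)) (trans (powerSum-scale i a≢0) (sym (*-identityʳ _))))

  monic : ∀ n → Vec (⊤ → Carrier) (suc n)
  monic zero    = (λ _ → 𝟙) ∷ []
  monic (suc n) = (λ _ → 𝟘) ∷ monic n

  ev-monic : ∀ n μ → ev (monic n) μ tt ≡ μ ↑ n
  ev-monic zero    μ = trans (cong (𝟙 ⊕_) (zeroʳ μ)) (+-identityʳ 𝟙)
  ev-monic (suc n) μ = trans (+-identityˡ _) (cong (μ ⊗_) (ev-monic n μ))

  -- For the zero subspace over a one-point set, `extract` says that a polynomial with at least as
  -- many zeros as coefficients is zero.
  vanishing : Subspace {⊤} (λ g → g tt ≡ 𝟘)
  vanishing = record
    { ext   = λ e g≡0 → trans (sym (e tt)) g≡0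
    ; null  = refl
    ; add   = λ a b → trans (cong₂ _⊕_ a b) (+-identityˡ 𝟘)
    ; scale = λ c a → trans (cong (c ⊗_) a) (zeroʳ c)
    }

  -- For i = 0 the sum is q·1 = 0. For i > 0, a nonzero sum would force a^i = 1 for all a ≠ 0,
  -- because x ↦ ax permutes the field; then x^(i+1) - x would vanish at all q points while having
  -- only i + 2 ≤ q coefficients.
  powerSum-small : ∀ {i} → i < q ∸ 1 → powerSum i ≡ 𝟘
  powerSum-small {zero} _ = trans (∑-const elements 𝟙) (trans (*-identityʳ _) (trans (cong nat size) nat-q≡0))
  powerSum-small {suc i} i< = decidable-stable (powerSum (suc i) ≟ 𝟘) λ S≢0 →
    case (extract vanishing elements unique
           (subst (suc (suc (suc i)) ≤_) (sym size) (subst (suc (suc (suc i)) ≤_) (sym q≡1+[q-1]) (s≤s i<)))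
           x^[i+2]-x (λ {μ} _ → root S≢0 μ))
    where
    x^[i+2]-x : Vec (⊤ → Carrier) (suc (suc (suc i)))
    x^[i+2]-x = (λ _ → 𝟘) ∷ (λ _ → ⊖ 𝟙) ∷ monic i
    root : ¬ powerSum (suc i) ≡ 𝟘 → ∀ μ → ev x^[i+2]-x μ tt ≡ 𝟘
    root S≢0 μ with μ ≟ 𝟘
    ... | yes refl = trans (+-identityˡ _) (zeroˡ _)
    ... | no μ≢0   = begin
      𝟘 ⊕ μ ⊗ (⊖ 𝟙 ⊕ μ ⊗ ev (monic i) μ tt)  ≡⟨ cong (λ e → 𝟘 ⊕ μ ⊗ (⊖ 𝟙 ⊕ μ ⊗ e)) (ev-monic i μ) ⟩
      𝟘 ⊕ μ ⊗ (⊖ 𝟙 ⊕ μ ↑ suc i)              ≡⟨ cong (λ e → 𝟘 ⊕ μ ⊗ (⊖ 𝟙 ⊕ e)) (powerSum≢0⇒↑≡1 (suc i) S≢0 μ≢0) ⟩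
      𝟘 ⊕ μ ⊗ (⊖ 𝟙 ⊕ 𝟙)                      ≡⟨ cong (λ e → 𝟘 ⊕ μ ⊗ e) (-‿inverseˡ 𝟙) ⟩
      𝟘 ⊕ μ ⊗ 𝟘                              ≡⟨ trans (+-identityˡ _) (zeroʳ μ) ⟩
      𝟘                                      ∎
    case : VAll (λ g → g tt ≡ 𝟘) x^[i+2]-x → ⊥
    case (_ ∷ -1≡0 ∷ _) = ⊖-nonzero (0≢1 ∘ sym) -1≡0

  δ : Carrier → Carrier
  δ x with x ≟ 𝟘
  ... | yes _ = 𝟙
  ... | no _  = 𝟘

  δ-0 : δ 𝟘 ≡ 𝟙
  δ-0 with 𝟘 ≟ 𝟘
  ... | yes _  = refl
  ... | no 0≢0 = ⊥-elim (0≢0 refl)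

  δ-≢0 : ∀ {x} → ¬ x ≡ 𝟘 → δ x ≡ 𝟘
  δ-≢0 {x} x≢0 with x ≟ 𝟘
  ... | yes x≡0 = ⊥-elim (x≢0 x≡0)
  ... | no _    = refl

  ∑-δ : ∑ elements δ ≡ 𝟙
  ∑-δ = one elements unique (complete 𝟘)
    where
    none : ∀ xs → All (λ x → ¬ 𝟘 ≡ x) xs → ∑ xs δ ≡ 𝟘
    none []       []       = refl
    none (x ∷ xs) (n ∷ ns) = trans (cong₂ _⊕_ (δ-≢0 (n ∘ sym)) (none xs ns)) (+-identityˡ 𝟘)
    one : ∀ xs → Unique xs → 𝟘 ∈ xs → ∑ xs δ ≡ 𝟙
    one (_ ∷ xs) (n ∷ u) (here refl) = trans (cong₂ _⊕_ δ-0 (none xs n)) (+-identityʳ 𝟙)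
    one (_ ∷ xs) (n ∷ u) (there i)   =
      trans (cong₂ _⊕_ (δ-≢0 (All.lookup n i)) (one xs u i)) (+-identityˡ 𝟙)

  ∑-ev : ∀ {n} j (vs : Vec (⊤ → Carrier) n) → (∀ i → i < j + n → powerSum i ≡ 𝟘) →
         ∑ elements (λ x → x ↑ j ⊗ ev vs x tt) ≡ 𝟘
  ∑-ev j [] _ = trans (∑-cong elements (λ x → zeroʳ (x ↑ j))) (∑-zero elements)
  ∑-ev {suc n} j (v ∷ vs) small = begin
    ∑ elements (λ x → x ↑ j ⊗ (v tt ⊕ x ⊗ ev vs x tt))
      ≡⟨ ∑-cong elements (λ x → solve 4 (λ p v x e → p :* (v :+ x :* e) := v :* p :+ (x :* p) :* e)
                                   refl (x ↑ j) (v tt) x (ev vs x tt)) ⟩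
    ∑ elements (λ x → v tt ⊗ x ↑ j ⊕ x ↑ suc j ⊗ ev vs x tt)
      ≡⟨ ∑-+ elements _ _ ⟩
    ∑ elements (λ x → v tt ⊗ x ↑ j) ⊕ ∑ elements (λ x → x ↑ suc j ⊗ ev vs x tt)
      ≡⟨ cong₂ _⊕_ (trans (∑-*ˡ elements (v tt) (_↑ j))
                     (trans (cong (v tt ⊗_) (small j (ℕ.m<m+n j (s≤s z≤n)))) (zeroʳ _)))
                   (∑-ev (suc j) vs (λ i i< → small i (subst (i <_) (sym (ℕ.+-suc j n)) i<))) ⟩
    𝟘 ⊕ 𝟘
      ≡⟨ +-identityˡ 𝟘 ⟩
    𝟘 ∎

  -- Otherwise all functions F → F, being polynomials, would have sum zero, but δ has not.
  powerSum-top≢0 : ¬ powerSum (q ∸ 1) ≡ 𝟘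
  powerSum-top≢0 S≡0 = 0≢1 (begin
    𝟘                                             ≡⟨ ∑-ev 0 (proj₁ poly) small ⟨
    ∑ elements (λ x → 𝟙 ⊗ ev (proj₁ poly) x tt)   ≡⟨ ∑-cong elements (λ x → trans (*-identityˡ _) (sym (proj₂ poly (complete x) tt))) ⟩
    ∑ elements δ                                  ≡⟨ ∑-δ ⟩
    𝟙                                             ∎)
    where
    poly = interpolate elements unique (λ x _ → δ x)
    small : ∀ i → i < length elements → powerSum i ≡ 𝟘
    small i i< with ℕ.m≤n⇒m<n∨m≡n (ℕ.≤-pred (subst (i <_) (trans size q≡1+[q-1]) i<))
    ... | inj₁ i<q-1 = powerSum-small i<q-1
    ... | inj₂ refl  = S≡0

  -- The scaling argument again: `powerSum (q ∸ 1)` is nonzero and is invariant under multiplication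
  -- by a^(q-1).
  fermat : ∀ {x} → ¬ x ≡ 𝟘 → x ↑ (q ∸ 1) ≡ 𝟙
  fermat = powerSum≢0⇒↑≡1 (q ∸ 1) powerSum-top≢0

  0<q-1 : 0 < q ∸ 1
  0<q-1 = ℕ.≤∧≢⇒< z≤n λ e → powerSum-top≢0 (subst (λ i → powerSum i ≡ 𝟘) e
    (trans (∑-const elements 𝟙) (trans (*-identityʳ _) (trans (cong nat size) nat-q≡0))))

  fermat-δ : ∀ x → x ↑ (q ∸ 1) ⊕ δ x ≡ 𝟙
  fermat-δ x with x ≟ 𝟘
  ... | yes refl = trans (cong (_⊕ 𝟙) (𝟘-↑ 0<q-1)) (+-identityˡ 𝟙)
  ... | no x≢0   = trans (+-identityʳ _) (fermat x≢0)

  -- This is x^(q-1) = 1 - δ(x) under the sum, arranged so that no subtraction occurs.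
  ∑-top : ∀ f → ∑ elements (λ x → x ↑ (q ∸ 1) ⊗ f x) ⊕ f 𝟘 ≡ ∑ elements f
  ∑-top f = begin
    ∑ elements (λ x → x ↑ (q ∸ 1) ⊗ f x) ⊕ f 𝟘
      ≡⟨ cong (∑ elements (λ x → x ↑ (q ∸ 1) ⊗ f x) ⊕_) at0 ⟨
    ∑ elements (λ x → x ↑ (q ∸ 1) ⊗ f x) ⊕ ∑ elements (λ x → δ x ⊗ f x)
      ≡⟨ ∑-+ elements _ _ ⟨
    ∑ elements (λ x → x ↑ (q ∸ 1) ⊗ f x ⊕ δ x ⊗ f x)
      ≡⟨ ∑-cong elements (λ x → trans (sym (distribʳ _ _ _)) (trans (cong (_⊗ f x) (fermat-δ x)) (*-identityˡ _))) ⟩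
    ∑ elements f ∎
    where
    δ-eval : ∀ x → δ x ⊗ f x ≡ δ x ⊗ f 𝟘
    δ-eval x with x ≟ 𝟘
    ... | yes refl = refl
    ... | no _     = trans (zeroˡ _) (sym (zeroˡ _))
    at0 : ∑ elements (λ x → δ x ⊗ f x) ≡ f 𝟘
    at0 = trans (∑-cong elements δ-eval) (trans (∑-*ʳ elements (f 𝟘) δ) (trans (cong (_⊗ f 𝟘) ∑-δ) (*-identityˡ _)))

-- Characteristic p: factorials, binomial coefficients and the Frobenius map.

module Characteristic {q : ℕ} (F : FiniteField q) (p k : ℕ) (p-prime : Prime p) (q≡p^k : q ≡ p ^ k) where
  open Field F
  open ≡-Reasoning
  open import Algebra.Properties.Semiring.Sum semiring using (sum)
  open import Algebra.Properties.Semiring.Mult semiring using () renaming (_×_ to _×ˢ_)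
  open import Algebra.Properties.Semiring.Exp semiring using () renaming (_^_ to _^ˢ_)
  import Algebra.Properties.Semiring.Sum semiring as Sum
  import Algebra.Properties.CommutativeSemiring.Binomial commutativeSemiring as Binomial

  nat-p≡0 : nat p ≡ 𝟘
  nat-p≡0 = decidable-stable (nat p ≟ 𝟘) λ p≢0 →
    ↑-nonzero k p≢0 (trans (sym (nat-^ p k)) (trans (cong nat (sym q≡p^k)) nat-q≡0))

  nat-multiple : ∀ x → nat (x * p) ≡ 𝟘
  nat-multiple x = trans (nat-* x p) (trans (cong (nat x ⊗_) nat-p≡0) (zeroʳ _))

  nat-coprime : ∀ {j} → Coprime p j → ¬ nat j ≡ 𝟘
  nat-coprime {j} cop j≡0 with coprime-Bézout cop
  ... | Bézout.+- x y eq = 0≢1 (sym (begin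
    𝟙                   ≡⟨ trans (+-identityʳ (𝟙 ⊕ 𝟘)) (+-identityʳ 𝟙) ⟨
    nat 1 ⊕ 𝟘           ≡⟨ cong (nat 1 ⊕_) (trans (cong (nat y ⊗_) j≡0) (zeroʳ _)) ⟨
    nat 1 ⊕ nat y ⊗ nat j ≡⟨ cong (nat 1 ⊕_) (nat-* y j) ⟨
    nat 1 ⊕ nat (y * j) ≡⟨ nat-+ 1 (y * j) ⟨
    nat (1 + y * j)     ≡⟨ cong nat eq ⟩
    nat (x * p)         ≡⟨ nat-multiple x ⟩
    𝟘                   ∎))
  ... | Bézout.-+ x y eq = 0≢1 (sym (begin
    𝟙                   ≡⟨ trans (+-identityʳ (𝟙 ⊕ 𝟘)) (+-identityʳ 𝟙) ⟨
    nat 1 ⊕ 𝟘           ≡⟨ cong (nat 1 ⊕_) (nat-multiple x) ⟨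
    nat 1 ⊕ nat (x * p) ≡⟨ nat-+ 1 (x * p) ⟨
    nat (1 + x * p)     ≡⟨ cong nat eq ⟩
    nat (y * j)         ≡⟨ trans (nat-* y j) (trans (cong (nat y ⊗_) j≡0) (zeroʳ _)) ⟩
    𝟘                   ∎))

  nat-nonzero : ∀ {j} → ¬ p ∣ j → ¬ nat j ≡ 𝟘
  nat-nonzero ¬p∣j = nat-coprime λ (d∣p , d∣j) →
    [ (λ d≡1 → d≡1) , (λ d≡p → ⊥-elim (¬p∣j (subst (_∣ _) d≡p d∣j))) ]′ (prime⇒irreducible p-prime d∣p)

  nat-!-nonzero : ∀ {j} → j < p → ¬ nat (j !) ≡ 𝟘
  nat-!-nonzero {zero}  _   e = 0≢1 (sym (trans (sym (+-identityʳ 𝟙)) e))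
  nat-!-nonzero {suc j} j<p e = *-nonzero
    (nat-nonzero λ p∣ → ℕ.<⇒≱ j<p (∣⇒≤ p∣)) (nat-!-nonzero (ℕ.<-trans (ℕ.n<1+n j) j<p))
    (trans (sym (nat-* (suc j) (j !))) e)

  ×-nat : ∀ n x → n ×ˢ x ≡ nat n ⊗ x
  ×-nat zero    x = sym (zeroˡ x)
  ×-nat (suc n) x = trans (cong (x ⊕_) (×-nat n x))
    (solve 2 (λ x y → y :+ x :* y := (con 1 :+ x) :* y) refl (nat n) x)

  ^-↑ : ∀ x n → x ^ˢ n ≡ x ↑ n
  ^-↑ x zero    = refl
  ^-↑ x (suc n) = cong (x ⊗_) (^-↑ x n)

  binomialTerm : ∀ (n : ℕ) (x y : Carrier) → Fin (suc n) → Carrier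
  binomialTerm n x y i = nat (n C toℕ i) ⊗ (x ↑ toℕ i ⊗ y ↑ (n ∸ toℕ i))

  binomial : ∀ n x y → (x ⊕ y) ↑ n ≡ sum (binomialTerm n x y)
  binomial n x y = begin
    (x ⊕ y) ↑ n                        ≡⟨ ^-↑ (x ⊕ y) n ⟨
    (x ⊕ y) ^ˢ n                       ≡⟨ Binomial.theorem n x y ⟩
    Binomial.binomialExpansion x y n   ≡⟨ Sum.sum-cong-≋ {suc n} (λ i → trans (×-nat (n C toℕ i) _)
                                            (cong (nat (n C toℕ i) ⊗_) (cong₂ _⊗_ (^-↑ x (toℕ i)) (^-↑ y (n ∸ toℕ i))))) ⟩
    sum (binomialTerm n x y)           ∎

  sum-zero : ∀ {n} (f : Fin n → Carrier) → (∀ i → f i ≡ 𝟘) → sum f ≡ 𝟘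
  sum-zero {zero}  f e = refl
  sum-zero {suc n} f e = trans (cong₂ _⊕_ (e zero) (sum-zero (f ∘ suc) (e ∘ suc))) (+-identityˡ 𝟘)

  sum-last : ∀ {n} (f : Fin (suc n) → Carrier) → (∀ i → toℕ i < n → f i ≡ 𝟘) → sum f ≡ f (fromℕ n)
  sum-last {zero}  f e = +-identityʳ _
  sum-last {suc n} f e = trans (cong₂ _⊕_ (e zero (s≤s z≤n)) (sum-last (f ∘ suc) (λ i i< → e (suc i) (s≤s i<)))) (+-identityˡ _)

  -- In p! = C(p,j) · j! · (p - j)! the left side vanishes in the field, whereas j! and (p - j)! do
  -- not, their factors being smaller than p.
  nat-pCj≡0 : ∀ {j} → 0 < j → j < p → nat (p C j) ≡ 𝟘
  nat-pCj≡0 {j} 0<j j<p = decidable-stable (nat (p C j) ≟ 𝟘) λ C≢0 →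
    *-nonzero C≢0 (*-nonzero (nat-!-nonzero j<p) (nat-!-nonzero (ℕ.∸-monoʳ-< 0<j (ℕ.<⇒≤ j<p)))) (begin
      nat (p C j) ⊗ (nat (j !) ⊗ nat ((p ∸ j) !))  ≡⟨ trans (nat-* (p C j) _) (cong (nat (p C j) ⊗_) (nat-* (j !) _)) ⟨
      nat ((p C j) * (j ! * (p ∸ j) !))              ≡⟨ cong nat factorials ⟩
      nat (p !)                                    ≡⟨ nat-p!≡0 ⟩
      𝟘                                            ∎)
    where
    instance
      j!≢0 = j !* (p ∸ j) !≢0
    factorials : (p C j) * (j ! * (p ∸ j) !) ≡ p !
    factorials = trans (cong (_* (j ! * (p ∸ j) !)) (nCk≡n!/k![n-k]! (ℕ.<⇒≤ j<p)))
                       (DivMod.m/n*n≡m (k![n∸k]!∣n! (ℕ.<⇒≤ j<p)))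
    nat-n!≡0 : ∀ n → NonZero n → nat n ≡ 𝟘 → nat (n !) ≡ 𝟘
    nat-n!≡0 (suc n) _ n≡0 = trans (nat-* (suc n) (n !)) (trans (cong (_⊗ nat (n !)) n≡0) (zeroˡ _))
    nat-p!≡0 : nat (p !) ≡ 𝟘
    nat-p!≡0 = nat-n!≡0 p (prime⇒nonZero p-prime) nat-p≡0

  frobenius : ∀ x y → (x ⊕ y) ↑ p ≡ x ↑ p ⊕ y ↑ p
  frobenius x y = trans (binomial p x y) (ends p (>-nonZero⁻¹ p {{prime⇒nonZero p-prime}}) refl)
    where
    ends : ∀ n → 0 < n → n ≡ p → sum (binomialTerm n x y) ≡ x ↑ n ⊕ y ↑ n
    ends (suc n) _ refl = begin
      binomialTerm p x y zero ⊕ sum (binomialTerm p x y ∘ suc)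
        ≡⟨ cong₂ _⊕_ first (trans (sum-last (binomialTerm p x y ∘ suc) middle) last) ⟩
      y ↑ p ⊕ x ↑ p
        ≡⟨ +-comm _ _ ⟩
      x ↑ p ⊕ y ↑ p ∎
      where
      first : nat (p C 0) ⊗ (𝟙 ⊗ y ↑ p) ≡ y ↑ p
      first = solve 1 (λ y → (con 1 :+ con 0) :* (con 1 :* y) := y) refl (y ↑ p)
      middle : ∀ i → toℕ i < n → binomialTerm p x y (suc i) ≡ 𝟘
      middle i i<n = trans (cong (_⊗ (x ↑ suc (toℕ i) ⊗ y ↑ (p ∸ suc (toℕ i)))) (nat-pCj≡0 (s≤s z≤n) (s≤s i<n))) (zeroˡ _)
      last : binomialTerm p x y (fromℕ p) ≡ x ↑ p
      last rewrite Fin.toℕ-fromℕ n | nCn≡1 p | ℕ.n∸n≡0 n =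
        solve 1 (λ x → (con 1 :+ con 0) :* (x :* con 1) := x) refl (x ↑ p)

  frobenius^ : ∀ u x y → (x ⊕ y) ↑ (p ^ u) ≡ x ↑ (p ^ u) ⊕ y ↑ (p ^ u)
  frobenius^ zero    x y = solve 2 (λ x y → (x :+ y) :* con 1 := x :* con 1 :+ y :* con 1) refl x y
  frobenius^ (suc u) x y = begin
    (x ⊕ y) ↑ (p * p ^ u)                    ≡⟨ ↑-* (x ⊕ y) (p ^ u) p ⟩
    ((x ⊕ y) ↑ (p ^ u)) ↑ p                  ≡⟨ cong (_↑ p) (frobenius^ u x y) ⟩
    (x ↑ (p ^ u) ⊕ y ↑ (p ^ u)) ↑ p          ≡⟨ frobenius _ _ ⟩
    (x ↑ (p ^ u)) ↑ p ⊕ (y ↑ (p ^ u)) ↑ p    ≡⟨ cong₂ _⊕_ (↑-* x (p ^ u) p) (↑-* y (p ^ u) p) ⟨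
    x ↑ (p * p ^ u) ⊕ y ↑ (p * p ^ u)        ∎

  frobenius-injective : ∀ u {x y} → x ↑ (p ^ u) ≡ y ↑ (p ^ u) → x ≡ y
  frobenius-injective u {x} {y} e = x-y≡0⇒x≡y (decidable-stable (x ⊕ ⊖ y ≟ 𝟘) λ d≢0 →
    ↑-nonzero (p ^ u) d≢0 (sym (+-cancelˡ (y ↑ (p ^ u)) _ _ (begin
      y ↑ (p ^ u) ⊕ 𝟘                     ≡⟨ +-identityʳ _ ⟩
      y ↑ (p ^ u)                         ≡⟨ e ⟨
      x ↑ (p ^ u)                         ≡⟨ cong (_↑ (p ^ u)) (y+[x-y]≡x x y) ⟨
      (y ⊕ (x ⊕ ⊖ y)) ↑ (p ^ u)           ≡⟨ frobenius^ u y (x ⊕ ⊖ y) ⟩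
      y ↑ (p ^ u) ⊕ (x ⊕ ⊖ y) ↑ (p ^ u)   ∎))))

-- Sums over points, formal polynomials and their degree.

module Polynomials {q : ℕ} (F : FiniteField q) where
  open Field F
  open PowerSums F
  open ≡-Reasoning

  module _ {X Y : Set} where
    ∑-product : ∀ (xs : List X) (ys : List Y) f g →
                ∑ xs (λ x → ∑ ys (λ y → f x ⊗ g y)) ≡ ∑ xs f ⊗ ∑ ys g
    ∑-product xs ys f g = trans (∑-cong xs (λ x → ∑-*ˡ ys (f x) g)) (∑-*ʳ xs (∑ ys g) f)

  ∑-points-[] : ∀ (g : Vec Carrier 0 → Carrier) → ∑ (points F 0) g ≡ g []
  ∑-points-[] g = +-identityʳ (g [])

  ∑-points-∷ : ∀ {n} (g : Vec Carrier (suc n) → Carrier) →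
               ∑ (points F (suc n)) g ≡ ∑ elements (λ x → ∑ (points F n) (λ v → g (x ∷ v)))
  ∑-points-∷ {n} g = trans (∑-concatMap (λ x → map (x ∷_) (points F n)) elements g)
    (∑-cong elements (λ x → ∑-map (x ∷_) (points F n) g))

  ∑-points-++ : ∀ m {n} (g : Vec Carrier (m + n) → Carrier) →
                ∑ (points F (m + n)) g ≡ ∑ (points F m) (λ u → ∑ (points F n) (λ w → g (u Vec.++ w)))
  ∑-points-++ zero    g = sym (∑-points-[] (λ u → ∑ (points F _) (λ w → g (u Vec.++ w))))
  ∑-points-++ (suc m) {n} g = begin
    ∑ (points F (suc m + n)) g
      ≡⟨ ∑-points-∷ g ⟩
    ∑ elements (λ x → ∑ (points F (m + n)) (λ v → g (x ∷ v)))
      ≡⟨ ∑-cong elements (λ x → ∑-points-++ m (λ v → g (x ∷ v))) ⟩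
    ∑ elements (λ x → ∑ (points F m) (λ u → ∑ (points F n) (λ w → g (x ∷ u Vec.++ w))))
      ≡⟨ ∑-points-∷ (λ u → ∑ (points F n) (λ w → g (u Vec.++ w))) ⟨
    ∑ (points F (suc m)) (λ u → ∑ (points F n) (λ w → g (u Vec.++ w))) ∎

  mono : ∀ {n} → Vec ℕ n → Vec Carrier n → Carrier
  mono a x = monomialValue F a x

  mono-++ : ∀ {m n} (a : Vec ℕ m) (b : Vec ℕ n) x y → mono (a Vec.++ b) (x Vec.++ y) ≡ mono a x ⊗ mono b y
  mono-++ []      b []      y = sym (*-identityˡ _)
  mono-++ (i ∷ a) b (z ∷ x) y = trans (cong (z ↑ i ⊗_) (mono-++ a b x y)) (sym (*-assoc _ _ _))

  mono-+ : ∀ {n} (a b : Vec ℕ n) x → mono (Vec.zipWith _+_ a b) x ≡ mono a x ⊗ mono b x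
  mono-+ []      []      []      = sym (*-identityˡ _)
  mono-+ (i ∷ a) (j ∷ b) (z ∷ x) = trans (cong₂ _⊗_ (↑-+ z i j) (mono-+ a b x))
    (solve 4 (λ s t u v → s :* t :* (u :* v) := s :* u :* (t :* v)) refl (z ↑ i) (z ↑ j) (mono a x) (mono b x))

  mono-0 : ∀ {n} (x : Vec Carrier n) → mono (Vec.replicate n 0) x ≡ 𝟙
  mono-0 []      = refl
  mono-0 (z ∷ x) = trans (*-identityˡ _) (mono-0 x)

  ∑-mono-∷ : ∀ {n} i (a : Vec ℕ n) → ∑ (points F (suc n)) (mono (i ∷ a)) ≡ powerSum i ⊗ ∑ (points F n) (mono a)
  ∑-mono-∷ i a = trans (∑-points-∷ (mono (i ∷ a))) (∑-product elements (points F _) (_↑ i) (mono a))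

  -- The sum factors over the coordinates, and some exponent is below q - 1. Exponents above q - 1
  -- are allowed, so that f ∘ T and its product with H_e can be treated without reducing them modulo
  -- x^q - x.
  ∑-mono-small : ∀ {n} (a : Vec ℕ n) → Vec.sum a < n * (q ∸ 1) → ∑ (points F n) (mono a) ≡ 𝟘
  ∑-mono-small {suc n} (i ∷ a) small with i ℕ.<? q ∸ 1
  ... | yes i<q-1 = trans (∑-mono-∷ i a) (trans (cong (_⊗ _) (powerSum-small i<q-1)) (zeroˡ _))
  ... | no  i≮q-1 = trans (∑-mono-∷ i a) (trans (cong (powerSum i ⊗_) (∑-mono-small a rest)) (zeroʳ _))
    where
    rest : Vec.sum a < n * (q ∸ 1)
    rest = ℕ.+-cancelˡ-< (q ∸ 1) _ _ (ℕ.≤-<-trans (ℕ.+-monoˡ-≤ (Vec.sum a) (ℕ.≮⇒≥ i≮q-1)) small)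

  sum-zipWith-+ : ∀ {n} (a b : Vec ℕ n) → Vec.sum (Vec.zipWith _+_ a b) ≡ Vec.sum a + Vec.sum b
  sum-zipWith-+ []      []      = refl
  sum-zipWith-+ (i ∷ a) (j ∷ b) = trans (cong (i + j +_) (sum-zipWith-+ a b)) (+-interchange i j _ _)

  -- Linear functionals of the coefficients

  ⟪_,_⟫ : ∀ {m} → Poly F m → (Vec ℕ m → Carrier) → Carrier
  ⟪ R , φ ⟫ = ∑ R (λ t → proj₁ t ⊗ φ (proj₂ t))

  indicator : ∀ {m} → Vec ℕ m → Vec ℕ m → Carrier
  indicator a b with Vec.≡-dec ℕ._≟_ b a
  ... | yes _ = 𝟙
  ... | no  _ = 𝟘

  indicator-refl : ∀ {m} (a : Vec ℕ m) → indicator a a ≡ 𝟙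
  indicator-refl a with Vec.≡-dec ℕ._≟_ a a
  ... | yes _   = refl
  ... | no  a≢a = ⊥-elim (a≢a refl)

  indicator-≢ : ∀ {m} {a b : Vec ℕ m} → ¬ b ≡ a → indicator a b ≡ 𝟘
  indicator-≢ {a = a} {b} b≢a with Vec.≡-dec ℕ._≟_ b a
  ... | yes b≡a = ⊥-elim (b≢a b≡a)
  ... | no  _   = refl

  -- The summand of coeff is local to its definition; unification recovers it.
  summand : ∀ {m} → Poly F m → Vec ℕ m → Carrier × Vec ℕ m → Carrier
  summand R a = found R (refl {x = coeff F R a})
    where
    found : ∀ {s : Carrier} {g : Carrier × Vec ℕ _ → Carrier} (R : Poly F _) → s ≡ sumF F (map g R) →
            Carrier × Vec ℕ _ → Carrier
    found {g = g} _ _ = g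

  summand-indicator : ∀ {m} (R : Poly F m) a c b → summand R a (c , b) ≡ c ⊗ indicator a b
  summand-indicator R a c b with Vec.≡-dec ℕ._≟_ b a
  ... | yes _ = sym (*-identityʳ c)
  ... | no  _ = sym (zeroʳ c)

  coeff-⟪⟫ : ∀ {m} (R : Poly F m) a → coeff F R a ≡ ⟪ R , indicator a ⟫
  coeff-⟪⟫ R a = ∑-cong R (λ (c , b) → summand-indicator R a c b)

  zipWith-+-cancelˡ : ∀ {n} (a : Vec ℕ n) {b c} → Vec.zipWith _+_ a b ≡ Vec.zipWith _+_ a c → b ≡ c
  zipWith-+-cancelˡ []      {[]}    {[]}    _ = refl
  zipWith-+-cancelˡ (i ∷ a) {_ ∷ _} {_ ∷ _} e =
    cong₂ _∷_ (ℕ.+-cancelˡ-≡ i _ _ (Vec.∷-injectiveˡ e)) (zipWith-+-cancelˡ a (Vec.∷-injectiveʳ e))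

  indicator-shift : ∀ {n} (a b c : Vec ℕ n) → indicator (Vec.zipWith _+_ a b) (Vec.zipWith _+_ a c) ≡ indicator b c
  indicator-shift a b c with Vec.≡-dec ℕ._≟_ c b
  ... | yes refl = indicator-refl (Vec.zipWith _+_ a b)
  ... | no c≢b   = indicator-≢ (c≢b ∘ zipWith-+-cancelˡ a)

  ∑-All-zero : ∀ {X : Set} {xs : List X} {f : X → Carrier} → All (λ x → f x ≡ 𝟘) xs → ∑ xs f ≡ 𝟘
  ∑-All-zero []       = refl
  ∑-All-zero (e ∷ es) = trans (cong₂ _⊕_ e (∑-All-zero es)) (+-identityˡ 𝟘)

  delete : ∀ {m} → Vec ℕ m → Poly F m → Poly F m
  delete a = filter (λ t → ¬? (Vec.≡-dec ℕ._≟_ (proj₂ t) a))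

  -- An exponent may be listed several times, so all its terms are removed together; what they
  -- contribute is the coefficient times φ a.
  ⟪⟫-delete : ∀ {m} a (R : Poly F m) φ → ⟪ R , φ ⟫ ≡ ⟪ R , indicator a ⟫ ⊗ φ a ⊕ ⟪ delete a R , φ ⟫
  ⟪⟫-delete a [] φ = solve 1 (λ x → con 0 := con 0 :* x :+ con 0) refl (φ a)
  ⟪⟫-delete a ((c , b) ∷ R) φ with Vec.≡-dec ℕ._≟_ b a
  ... | yes refl = trans (cong (c ⊗ φ a ⊕_) (⟪⟫-delete a R φ))
    (solve 4 (λ c f s d → c :* f :+ (s :* f :+ d) := (c :* con 1 :+ s) :* f :+ d) refl
      c (φ a) ⟪ R , indicator a ⟫ ⟪ delete a R , φ ⟫)
  ... | no _     = trans (cong (c ⊗ φ b ⊕_) (⟪⟫-delete a R φ))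
    (solve 5 (λ c f s d e → c :* e :+ (s :* f :+ d) := (c :* con 0 :+ s) :* f :+ (c :* e :+ d)) refl
      c (φ a) ⟪ R , indicator a ⟫ ⟪ delete a R , φ ⟫ (φ b))

  -- Induction on the number of terms, deleting one exponent with all its repetitions. The
  -- hypothesis is on the product because it is met in two ways: all coefficients vanish in `≐⇒⟪⟫`,
  -- whereas in `⟪⟫-filter` φ may vanish instead.
  ⟪⟫-zero : ∀ {m} (R : Poly F m) φ → (∀ a → ⟪ R , indicator a ⟫ ⊗ φ a ≡ 𝟘) → ⟪ R , φ ⟫ ≡ 𝟘
  ⟪⟫-zero {m} R φ = go (length R) R ℕ.≤-refl
    where
    go : ∀ n (R : Poly F m) → length R ≤ n → (∀ a → ⟪ R , indicator a ⟫ ⊗ φ a ≡ 𝟘) → ⟪ R , φ ⟫ ≡ 𝟘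
    go n       []            _         _    = refl
    go (suc n) R@((c , a) ∷ R′) (s≤s len) zero-a =
      trans (⟪⟫-delete a R φ) (trans (cong₂ _⊕_ (zero-a a) (go n (delete a R) shorter zero-b)) (+-identityˡ 𝟘))
      where
      shorter : length (delete a R) ≤ n
      shorter with Vec.≡-dec ℕ._≟_ a a
      ... | yes _   = ℕ.≤-trans (List.length-filter _ R′) len
      ... | no  a≢a = ⊥-elim (a≢a refl)
      zero-b : ∀ b → ⟪ delete a R , indicator b ⟫ ⊗ φ b ≡ 𝟘
      zero-b b with Vec.≡-dec ℕ._≟_ a b
      ... | yes refl = trans (cong (_⊗ φ a) gone) (zeroˡ _)
        where
        gone : ⟪ delete a R , indicator a ⟫ ≡ 𝟘
        gone = +-cancelˡ ⟪ R , indicator a ⟫ _ _ (begin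
          ⟪ R , indicator a ⟫ ⊕ ⟪ delete a R , indicator a ⟫
            ≡⟨ cong (_⊕ ⟪ delete a R , indicator a ⟫) (trans (cong (⟪ R , indicator a ⟫ ⊗_) (indicator-refl a)) (*-identityʳ _)) ⟨
          ⟪ R , indicator a ⟫ ⊗ indicator a a ⊕ ⟪ delete a R , indicator a ⟫
            ≡⟨ ⟪⟫-delete a R (indicator a) ⟨
          ⟪ R , indicator a ⟫
            ≡⟨ +-identityʳ _ ⟨
          ⟪ R , indicator a ⟫ ⊕ 𝟘 ∎)
      ... | no a≢b = trans (cong (_⊗ φ b) kept) (zero-a b)
        where
        kept : ⟪ delete a R , indicator b ⟫ ≡ ⟪ R , indicator b ⟫
        kept = sym (trans (⟪⟫-delete a R (indicator b))
          (trans (cong (_⊕ ⟪ delete a R , indicator b ⟫) (trans (cong (⟪ R , indicator a ⟫ ⊗_) (indicator-≢ a≢b)) (zeroʳ _))) (+-identityˡ _)))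

  module _ {m} {Q : Vec ℕ m → Set} (Q? : ∀ a → Dec (Q a)) where
    outside : (Vec ℕ m → Carrier) → Vec ℕ m → Carrier
    outside φ a with Q? a
    ... | yes _ = 𝟘
    ... | no  _ = φ a

    ⟪⟫-split : ∀ φ R → ⟪ R , φ ⟫ ≡ ⟪ filter (λ t → Q? (proj₂ t)) R , φ ⟫ ⊕ ⟪ R , outside φ ⟫
    ⟪⟫-split φ []            = sym (+-identityˡ 𝟘)
    ⟪⟫-split φ ((c , a) ∷ R) with Q? a
    ... | yes _ = trans (cong (c ⊗ φ a ⊕_) (⟪⟫-split φ R))
      (solve 4 (λ c f s t → c :* f :+ (s :+ t) := c :* f :+ s :+ (c :* con 0 :+ t)) refl
        c (φ a) ⟪ filter (λ t → Q? (proj₂ t)) R , φ ⟫ ⟪ R , outside φ ⟫)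
    ... | no _  = trans (cong (c ⊗ φ a ⊕_) (⟪⟫-split φ R))
      (solve 4 (λ c f s t → c :* f :+ (s :+ t) := s :+ (c :* f :+ t)) refl
        c (φ a) ⟪ filter (λ t → Q? (proj₂ t)) R , φ ⟫ ⟪ R , outside φ ⟫)

    -- The difference of the two sides pairs R with `outside φ`; at every exponent either that
    -- function or the coefficient is zero.
    ⟪⟫-filter : ∀ R → (∀ a → ¬ Q a → ⟪ R , indicator a ⟫ ≡ 𝟘) → ∀ φ →
                ⟪ R , φ ⟫ ≡ ⟪ filter (λ t → Q? (proj₂ t)) R , φ ⟫
    ⟪⟫-filter R coeff≡0 φ = trans (⟪⟫-split φ R)
      (trans (cong (⟪ filter (λ t → Q? (proj₂ t)) R , φ ⟫ ⊕_) (⟪⟫-zero R (outside φ) cancels)) (+-identityʳ _))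
      where
      cancels : ∀ a → ⟪ R , indicator a ⟫ ⊗ outside φ a ≡ 𝟘
      cancels a with Q? a
      ... | yes _ = zeroʳ _
      ... | no ¬q = trans (cong (_⊗ φ a) (coeff≡0 a ¬q)) (zeroˡ _)

  scalePoly-⟪⟫ : ∀ {m} c (R : Poly F m) φ → ⟪ scalePoly F c R , φ ⟫ ≡ c ⊗ ⟪ R , φ ⟫
  scalePoly-⟪⟫ c R φ = trans (∑-map _ R _) (trans (∑-cong R (λ t → *-assoc c _ _)) (∑-*ˡ R c _))

  -- Applied to R - T, all of whose coefficients vanish. Taking φ = `λ a → mono a x` transports
  -- evaluation across `≐`, and φ = `indicator a` transports coefficients; this is how the defining
  -- equation of P is exploited.
  ≐⇒⟪⟫ : ∀ {m} (R T : Poly F m) → _≐_ F R T → ∀ φ → ⟪ R , φ ⟫ ≡ ⟪ T , φ ⟫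
  ≐⇒⟪⟫ R T R≐T φ = x-y≡0⇒x≡y (trans (sym (difference φ)) (⟪⟫-zero D φ
    (λ a → trans (cong (_⊗ φ a) (trans (difference (indicator a))
      (trans (cong (_⊕ ⊖ ⟪ T , indicator a ⟫) (trans (sym (coeff-⟪⟫ R a)) (trans (R≐T a) (coeff-⟪⟫ T a)))) (-‿inverseʳ _)))) (zeroˡ _))))
    where
    D = R ++ scalePoly F (⊖ 𝟙) T
    difference : ∀ ψ → ⟪ D , ψ ⟫ ≡ ⟪ R , ψ ⟫ ⊕ ⊖ ⟪ T , ψ ⟫
    difference ψ = trans (∑-++ R _ _) (cong (⟪ R , ψ ⟫ ⊕_) (trans (scalePoly-⟪⟫ (⊖ 𝟙) T ψ) (-1*x≈-x _)))

  -- mulPoly is the case of zipWith _+_; the case of _++_ gives products in disjoint variables.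
  module _ {l m n} (_∙_ : Vec ℕ l → Vec ℕ m → Vec ℕ n) where
    mulWith : Poly F l → Poly F m → Poly F n
    mulWith R T = concatMap (λ s → map (λ t → (proj₁ s ⊗ proj₁ t , proj₂ s ∙ proj₂ t)) T) R

    mulWith-⟪⟫ : ∀ R T {φ ψ χ} → (∀ a b → χ (a ∙ b) ≡ φ a ⊗ ψ b) → ⟪ mulWith R T , χ ⟫ ≡ ⟪ R , φ ⟫ ⊗ ⟪ T , ψ ⟫
    mulWith-⟪⟫ R T {φ} {ψ} {χ} χ-∙ = begin
      ⟪ mulWith R T , χ ⟫
        ≡⟨ ∑-concatMap _ R _ ⟩
      ∑ R (λ s → ∑ (map (λ t → (proj₁ s ⊗ proj₁ t , proj₂ s ∙ proj₂ t)) T) (λ t → proj₁ t ⊗ χ (proj₂ t)))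
        ≡⟨ ∑-cong R (λ s → trans (∑-map _ T _) (∑-cong T (λ t → trans (cong (proj₁ s ⊗ proj₁ t ⊗_) (χ-∙ (proj₂ s) (proj₂ t)))
             (solve 4 (λ c d f g → c :* d :* (f :* g) := c :* f :* (d :* g)) refl (proj₁ s) (proj₁ t) (φ (proj₂ s)) (ψ (proj₂ t)))))) ⟩
      ∑ R (λ s → ∑ T (λ t → proj₁ s ⊗ φ (proj₂ s) ⊗ (proj₁ t ⊗ ψ (proj₂ t))))
        ≡⟨ ∑-product R T _ _ ⟩
      ⟪ R , φ ⟫ ⊗ ⟪ T , ψ ⟫ ∎

    mulWith-All : ∀ {P : Vec ℕ l → Set} {Q : Vec ℕ m → Set} {S : Vec ℕ n → Set} →
                  (∀ {a b} → P a → Q b → S (a ∙ b)) → ∀ {R T} →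
                  All (P ∘ proj₂) R → All (Q ∘ proj₂) T → All (S ∘ proj₂) (mulWith R T)
    mulWith-All f []       qs = []
    mulWith-All f (p ∷ ps) qs = All.++⁺ (All.map⁺ (All.map (f p) qs)) (mulWith-All f ps qs)

  mulPoly-eval : ∀ {m} (R T : Poly F m) x → eval F (mulPoly F R T) x ≡ eval F R x ⊗ eval F T x
  mulPoly-eval R T x = mulWith-⟪⟫ (Vec.zipWith _+_) R T (λ a b → mono-+ a b x)

  powPoly-eval : ∀ {m} (R : Poly F m) n x → eval F (powPoly F R n) x ≡ eval F R x ↑ n
  powPoly-eval R zero    x = trans (+-identityʳ _) (trans (*-identityˡ _) (mono-0 x))
  powPoly-eval R (suc n) x = trans (mulPoly-eval R (powPoly F R n) x) (cong (eval F R x ⊗_) (powPoly-eval R n x))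

  Homogeneous : ∀ {m} → ℕ → Poly F m → Set
  Homogeneous D R = All (λ t → Vec.sum (proj₂ t) ≡ D) R

  homogeneous-coeff : ∀ {m D} {R : Poly F m} → Homogeneous D R → ∀ {a} → ¬ Vec.sum a ≡ D → ⟪ R , indicator a ⟫ ≡ 𝟘
  homogeneous-coeff hom {a} a≢D = ∑-All-zero (All.map
    (λ {t} e → trans (cong (proj₁ t ⊗_) (indicator-≢ {a = a} {proj₂ t} (λ b≡a → a≢D (trans (cong Vec.sum (sym b≡a)) e)))) (zeroʳ _)) hom)

  sum-replicate-0 : ∀ n → Vec.sum (Vec.replicate n 0) ≡ 0
  sum-replicate-0 zero    = refl
  sum-replicate-0 (suc n) = sum-replicate-0 n

  powPoly-homogeneous : ∀ {m} {R : Poly F m} → Homogeneous 1 R → ∀ n → Homogeneous n (powPoly F R n)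
  powPoly-homogeneous {m} hom zero    = sum-replicate-0 m ∷ []
  powPoly-homogeneous {m} hom (suc n) = mulWith-All (Vec.zipWith _+_)
    (λ {a} {b} e e′ → trans (sum-zipWith-+ a b) (cong₂ _+_ e e′)) hom (powPoly-homogeneous hom n)

  unitExp-suc : ∀ {m} (i : Fin m) → unitExp F (suc i) ≡ 0 ∷ unitExp F i
  unitExp-suc i = cong (0 ∷_) (Vec.tabulate-cong (λ j → cong (λ b → if b then 1 else 0) (same j)))
    where
    same : ∀ j → ⌊ suc i Fin.≟ suc j ⌋ ≡ ⌊ i Fin.≟ j ⌋
    same j with i Fin.≟ j
    ... | yes _ = refl
    ... | no  _ = refl

  unitExp-zero : ∀ {m} → unitExp F {suc m} zero ≡ 1 ∷ Vec.replicate m 0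
  unitExp-zero {m} = cong (1 ∷_) (zeros m)
    where
    zeros : ∀ m → Vec.tabulate (λ (j : Fin m) → 0) ≡ Vec.replicate m 0
    zeros zero    = refl
    zeros (suc m) = cong (0 ∷_) (zeros m)

  sum-unitExp : ∀ {m} (i : Fin m) → Vec.sum (unitExp F i) ≡ 1
  sum-unitExp {suc m} zero    = trans (cong Vec.sum (unitExp-zero {m})) (cong suc (sum-replicate-0 m))
  sum-unitExp {suc m} (suc i) = trans (cong Vec.sum (unitExp-suc i)) (sum-unitExp i)

  mono-unitExp : ∀ {m} (i : Fin m) x → mono (unitExp F i) x ≡ Vec.lookup x i
  mono-unitExp {suc m} zero (z ∷ x) = trans (cong (λ a → mono a (z ∷ x)) (unitExp-zero {m}))
    (trans (cong₂ _⊗_ (*-identityʳ z) (mono-0 x)) (*-identityʳ z))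
  mono-unitExp {suc m} (suc i) (z ∷ x) = trans (cong (λ a → mono a (z ∷ x)) (unitExp-suc i))
    (trans (*-identityˡ _) (mono-unitExp i x))

  -- Functions of bounded degree

  Low : ∀ {n} → ℕ → (Vec Carrier n → Carrier) → Set
  Low {n} D g = ∃ λ (R : Poly F n) → All (λ t → Vec.sum (proj₂ t) ≤ D) R × (∀ v → g v ≡ eval F R v)

  ∑-Low : ∀ {n D g} → Low {n} D g → D < n * (q ∸ 1) → ∑ (points F n) g ≡ 𝟘
  ∑-Low {n} (R , low , g≡) D< = begin
    ∑ (points F n) _                                                    ≡⟨ ∑-cong (points F n) g≡ ⟩
    ∑ (points F n) (λ v → ∑ R (λ t → proj₁ t ⊗ mono (proj₂ t) v))       ≡⟨ ∑-comm (points F n) R _ ⟩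
    ∑ R (λ t → ∑ (points F n) (λ v → proj₁ t ⊗ mono (proj₂ t) v))       ≡⟨ ∑-All-zero (All.map (λ {t} le →
        trans (∑-*ˡ (points F n) (proj₁ t) (mono (proj₂ t)))
        (trans (cong (proj₁ t ⊗_) (∑-mono-small (proj₂ t) (ℕ.≤-<-trans le D<))) (zeroʳ _))) low) ⟩
    𝟘                                                                   ∎

  Low-weaken : ∀ {n D E g} → D ≤ E → Low {n} D g → Low E g
  Low-weaken D≤E (R , low , g≡) = R , All.map (λ le → ℕ.≤-trans le D≤E) low , g≡

  Low-ext : ∀ {n D g h} → (∀ v → g v ≡ h v) → Low {n} D g → Low D h
  Low-ext e (R , low , g≡) = R , low , λ v → trans (sym (e v)) (g≡ v)

  Low-const : ∀ {n} c → Low {n} 0 (λ _ → c)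
  Low-const {n} c = (c , Vec.replicate n 0) ∷ [] , ℕ.≤-reflexive (sum-replicate-0 n) ∷ [] ,
    λ v → sym (trans (+-identityʳ _) (trans (cong (c ⊗_) (mono-0 v)) (*-identityʳ c)))

  Low-+ : ∀ {n D g h} → Low {n} D g → Low D h → Low D (λ v → g v ⊕ h v)
  Low-+ (R , lowR , g≡) (T , lowT , h≡) = R ++ T , All.++⁺ lowR lowT ,
    λ v → trans (cong₂ _⊕_ (g≡ v) (h≡ v)) (sym (∑-++ R T _))

  -- Serves products in the same variables, with both projections the identity, and products in
  -- disjoint variables, with `take` and `drop`.
  Low-mulWith : ∀ {l m n D E g h} {k : Vec Carrier n → Carrier} (_∙_ : Vec ℕ l → Vec ℕ m → Vec ℕ n) →
                (∀ a b → Vec.sum (a ∙ b) ≡ Vec.sum a + Vec.sum b) →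
                (left : Vec Carrier n → Vec Carrier l) (right : Vec Carrier n → Vec Carrier m) →
                (∀ a b v → mono (a ∙ b) v ≡ mono a (left v) ⊗ mono b (right v)) →
                (∀ v → k v ≡ g (left v) ⊗ h (right v)) →
                Low D g → Low E h → Low (D + E) k
  Low-mulWith _∙_ sum-∙ left right mono-∙ k≡ (R , lowR , g≡) (T , lowT , h≡) =
    mulWith _∙_ R T ,
    mulWith-All _∙_ (λ {a} {b} le le′ → ℕ.≤-trans (ℕ.≤-reflexive (sum-∙ a b)) (ℕ.+-mono-≤ le le′)) lowR lowT ,
    λ v → trans (k≡ v) (trans (cong₂ _⊗_ (g≡ (left v)) (h≡ (right v))) (sym (mulWith-⟪⟫ _∙_ R T (λ a b → mono-∙ a b v))))

  Low-* : ∀ {n D E g h} → Low {n} D g → Low E h → Low (D + E) (λ v → g v ⊗ h v)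
  Low-* = Low-mulWith (Vec.zipWith _+_) sum-zipWith-+ (λ v → v) (λ v → v) mono-+ (λ v → refl)

  Low-↑ : ∀ {n D g} → Low {n} D g → ∀ i → Low (i * D) (λ v → g v ↑ i)
  Low-↑ low zero    = Low-const 𝟙
  Low-↑ low (suc i) = Low-* low (Low-↑ low i)

  Low-++ : ∀ {m n D E g h} {k : Vec Carrier (m + n) → Carrier} →
           (∀ u w → k (u Vec.++ w) ≡ g u ⊗ h w) → Low D g → Low E h → Low (D + E) k
  Low-++ {m} {g = g} {h} {k} k≡ = Low-mulWith Vec._++_ (λ a _ → Vec.sum-++ a) (Vec.take m) (Vec.drop m)
    (λ a b v → trans (cong (mono (a Vec.++ b)) (sym (Vec.take++drop≡id m v))) (mono-++ a b (Vec.take m v) (Vec.drop m v)))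
    (λ v → trans (cong k (sym (Vec.take++drop≡id m v))) (k≡ _ _))

  Low-mono : ∀ {n} (a : Vec ℕ n) → Low (Vec.sum a) (mono a)
  Low-mono a = (𝟙 , a) ∷ [] , ℕ.≤-refl ∷ [] , λ v → sym (trans (+-identityʳ _) (*-identityˡ _))

-- The test polynomial P: its pairing with (x_1 ⋯ x_p)^γ, and its degree.

module TestPolynomial {q : ℕ} (F : FiniteField q) (p′ k′ : ℕ)
                      (p-prime : Prime (suc p′)) (q≡p^k : q ≡ suc p′ ^ suc k′) where
  open Field F
  open PowerSums F
  open Polynomials F
  open Characteristic F (suc p′) (suc k′) p-prime q≡p^k
  open import Algebra.Properties.Semiring.Sum semiring using (sum)
  open ≡-Reasoning

  -- The exponent α = γ - 1 is what x_1, ..., x_(p-1) retain after the division by their product. As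
  -- α + β = q - 1, one extra factor x^β raises x^α from vanishing power sum to the nonvanishing
  -- one.
  p β γ α : ℕ
  p = suc p′
  β = p ^ k′
  γ = p′ * β
  α = pred γ

  0<p′ : 0 < p′
  0<p′ = ℕ.≤-pred (nonTrivial⇒n>1 p {{prime⇒nonTrivial p-prime}})

  0<β : 0 < β
  0<β = ℕ.m^n>0 p k′

  0<γ : 0 < γ
  0<γ = ℕ.*-mono-≤ 0<p′ 0<β

  γ≡1+α : γ ≡ suc α
  γ≡1+α = sym (ℕ.suc-pred γ {{>-nonZero 0<γ}})

  β+α≡q-1 : β + α ≡ q ∸ 1
  β+α≡q-1 = cong pred (trans (sym (ℕ.+-suc β α)) (trans (cong (β +_) (sym γ≡1+α)) (sym q≡p^k)))

  α<q-1 : α < q ∸ 1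
  α<q-1 = subst (α <_) β+α≡q-1 (ℕ.m<n+m α 0<β)

  ∑-tabulate : ∀ {X : Set} n (g : Fin n → X) φ → ∑ (List.tabulate g) φ ≡ sum (φ ∘ g)
  ∑-tabulate zero    g φ = refl
  ∑-tabulate (suc n) g φ = cong (φ (g zero) ⊕_) (∑-tabulate n (g ∘ suc) φ)

  ∑-filter : ∀ {X : Set} (h : X → Bool) xs φ →
             ∑ (filter (λ x → h x Bool.≟ true) xs) φ ≡ ∑ xs (λ x → if h x then φ x else 𝟘)
  ∑-filter h []       φ = refl
  ∑-filter h (x ∷ xs) φ with h x
  ... | true  = cong (φ x ⊕_) (∑-filter h xs φ)
  ... | false = trans (∑-filter h xs φ) (sym (+-identityˡ _))

  linear : ∀ {n} → Subset n → Vec Carrier (suc n) → Carrier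
  linear []      (z ∷ []) = z
  linear (b ∷ I) (z ∷ x)  = (if b then z else 𝟘) ⊕ linear I x

  linPoly-eval : ∀ n I x → eval F (linPoly F n I) x ≡ linear I x
  linPoly-eval n I x = begin
    eval F (linPoly F n I) x
      ≡⟨ ∑-++ (map (λ i → (𝟙 , unitExp F (inject₁ i))) chosen) _ _ ⟩
    ∑ (map (λ i → (𝟙 , unitExp F (inject₁ i))) chosen) (λ t → proj₁ t ⊗ mono (proj₂ t) x) ⊕ (𝟙 ⊗ mono (unitExp F (fromℕ n)) x ⊕ 𝟘)
      ≡⟨ cong₂ _⊕_ (trans (∑-map _ chosen _) (∑-cong chosen (λ i → variable-eval (inject₁ i))))
                   (trans (+-identityʳ _) (variable-eval (fromℕ n))) ⟩
    ∑ chosen (λ i → Vec.lookup x (inject₁ i)) ⊕ Vec.lookup x (fromℕ n)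
      ≡⟨ cong (_⊕ Vec.lookup x (fromℕ n)) (trans (∑-filter (Vec.lookup I) (List.allFin n) _) (∑-tabulate n id _)) ⟩
    sum (λ i → if Vec.lookup I i then Vec.lookup x (inject₁ i) else 𝟘) ⊕ Vec.lookup x (fromℕ n)
      ≡⟨ unfold I x ⟩
    linear I x ∎
    where
    chosen = filter (λ i → Vec.lookup I i Bool.≟ true) (List.allFin n)
    variable-eval : ∀ i → 𝟙 ⊗ mono (unitExp F i) x ≡ Vec.lookup x i
    variable-eval i = trans (*-identityˡ _) (mono-unitExp i x)
    unfold : ∀ {n} (I : Subset n) x →
             sum (λ i → if Vec.lookup I i then Vec.lookup x (inject₁ i) else 𝟘) ⊕ Vec.lookup x (fromℕ n) ≡ linear I x
    unfold []      (z ∷ []) = +-identityˡ z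
    unfold (b ∷ I) (z ∷ x)  = trans (+-assoc _ _ _) (cong ((if b then z else 𝟘) ⊕_) (unfold I x))

  subsets : ∀ n → List (Subset n)
  subsets = allVecs (true ∷ false ∷ [])

  sign : ∀ {n} → Subset n → Carrier
  sign I = ⊖ 𝟙 ↑ (∣ I ∣ + 1)

  Qpoly-eval : ∀ x → eval F (Qpoly F p′) x ≡ ∑ (subsets p′) (λ I → sign I ⊗ linear I x ↑ (q ∸ 1))
  Qpoly-eval x = trans (∑-concatMap _ (subsets p′) _) (∑-cong (subsets p′) (λ I →
    trans (scalePoly-⟪⟫ (sign I) (powPoly F (linPoly F p′ I) (q ∸ 1)) _)
          (cong (sign I ⊗_) (trans (powPoly-eval (linPoly F p′ I) (q ∸ 1) x) (cong (_↑ (q ∸ 1)) (linPoly-eval p′ I x))))))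

  Qpoly-homogeneous : Homogeneous (q ∸ 1) (Qpoly F p′)
  Qpoly-homogeneous = over (subsets p′)
    where
    over : ∀ Is → Homogeneous (q ∸ 1) (concatMap (λ I → scalePoly F (sign I) (powPoly F (linPoly F p′ I) (q ∸ 1))) Is)
    over []       = []
    over (I ∷ Is) = All.++⁺ (All.map⁺ (powPoly-homogeneous (All.++⁺ (All.map⁺ (All.tabulate λ {i} _ → sum-unitExp (inject₁ i)))
                                                                    (sum-unitExp (fromℕ p′) ∷ [])) (q ∸ 1)))
                            (over Is)

  all : ∀ n → Subset n
  all n = Vec.replicate n true

  ∑-subsets : ∀ n (φ : Subset n → Carrier) → (∀ I → ¬ I ≡ all n → φ I ≡ 𝟘) → ∑ (subsets n) φ ≡ φ (all n)
  ∑-subsets zero    φ _  = +-identityʳ _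
  ∑-subsets (suc n) φ φ0 = begin
    ∑ (subsets (suc n)) φ
      ≡⟨ ∑-concatMap (λ b → map (b ∷_) (subsets n)) (true ∷ false ∷ []) φ ⟩
    ∑ (map (true ∷_) (subsets n)) φ ⊕ (∑ (map (false ∷_) (subsets n)) φ ⊕ 𝟘)
      ≡⟨ cong₂ (λ s t → s ⊕ (t ⊕ 𝟘))
           (trans (∑-map (true ∷_) (subsets n) φ) (∑-subsets n (φ ∘ (true ∷_)) (λ I I≢ → φ0 (true ∷ I) (I≢ ∘ Vec.∷-injectiveʳ))))
           (trans (∑-map (false ∷_) (subsets n) φ) (trans (∑-cong (subsets n) (λ I → φ0 (false ∷ I) λ ())) (∑-zero (subsets n)))) ⟩
    φ (all (suc n)) ⊕ (𝟘 ⊕ 𝟘)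
      ≡⟨ trans (cong (φ (all (suc n)) ⊕_) (+-identityˡ 𝟘)) (+-identityʳ _) ⟩
    φ (all (suc n)) ∎

  -- The exponents of (x_1 ⋯ x_p)^γ / (x_1 ⋯ x_(p-1)), for n = p - 1.
  weights : ∀ n → Vec ℕ (suc n)
  weights zero    = γ ∷ []
  weights (suc n) = α ∷ weights n

  divExp+weights : ∀ n → Vec.zipWith _+_ (weights n) (divExp F n) ≡ Vec.replicate (suc n) γ
  divExp+weights zero    = cong (_∷ []) (ℕ.+-identityʳ γ)
  divExp+weights (suc n) = cong₂ _∷_ (trans (ℕ.+-comm α 1) (sym γ≡1+α)) (divExp+weights n)

  -- The function h is left arbitrary because splitting off a variable translates its argument.
  weighted : ∀ {n} → Subset n → (Carrier → Carrier) → Carrier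
  weighted {n} I h = ∑ (points F (suc n)) (λ x → mono (weights n) x ⊗ h (linear I x))

  weighted-∷ : ∀ {n} b (I : Subset n) h →
               weighted (b ∷ I) h ≡ ∑ elements (λ z → z ↑ α ⊗ weighted I (λ y → h ((if b then z else 𝟘) ⊕ y)))
  weighted-∷ {n} b I h = trans (∑-points-∷ _) (∑-cong elements (λ z →
    trans (∑-cong (points F (suc n)) (λ x → *-assoc (z ↑ α) _ _)) (∑-*ˡ (points F (suc n)) (z ↑ α) _)))

  -- A variable outside I occurs only in its own factor z^α, and the power sum of exponent α < q - 1
  -- is zero.
  weighted-proper : ∀ {n} (I : Subset n) → ¬ I ≡ all n → ∀ h → weighted I h ≡ 𝟘
  weighted-proper []          I≢ h = ⊥-elim (I≢ refl)
  weighted-proper (true ∷ I)  I≢ h = trans (weighted-∷ true I h) (trans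
    (∑-cong elements (λ z → trans (cong (z ↑ α ⊗_) (weighted-proper I (I≢ ∘ cong (true ∷_)) (λ y → h (z ⊕ y)))) (zeroʳ _))) (∑-zero elements))
  weighted-proper (false ∷ I) I≢ h = trans (weighted-∷ false I h) (trans
    (∑-*ʳ elements _ (_↑ α)) (trans (cong (_⊗ weighted I (λ y → h (𝟘 ⊕ y))) (powerSum-small α<q-1)) (zeroˡ _)))

  total : ∀ {n} → Vec Carrier n → Carrier
  total []      = 𝟘
  total (z ∷ x) = z ⊕ total x

  weighted-all : ∀ n h → weighted (all n) h ≡
    ∑ (points F n) (λ x → mono (Vec.replicate n α) x ⊗ ∑ elements (λ z → z ↑ γ ⊗ h (total x ⊕ z)))
  weighted-all zero h = begin
    weighted (all 0) h
      ≡⟨ ∑-points-∷ _ ⟩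
    ∑ elements (λ z → ∑ (points F 0) (λ x → mono (γ ∷ []) (z ∷ x) ⊗ h (linear [] (z ∷ x))))
      ≡⟨ ∑-cong elements (λ z → trans (∑-points-[] (λ x → mono (γ ∷ []) (z ∷ x) ⊗ h (linear [] (z ∷ x))))
           (cong₂ (λ s t → s ⊗ h t) (*-identityʳ _) (sym (+-identityˡ z)))) ⟩
    ∑ elements (λ z → z ↑ γ ⊗ h (𝟘 ⊕ z))
      ≡⟨ trans (∑-points-[] (λ x → mono [] x ⊗ ∑ elements (λ z → z ↑ γ ⊗ h (total x ⊕ z)))) (*-identityˡ _) ⟨
    ∑ (points F 0) (λ x → mono [] x ⊗ ∑ elements (λ z → z ↑ γ ⊗ h (total x ⊕ z))) ∎
  weighted-all (suc n) h = begin
    weighted (all (suc n)) h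
      ≡⟨ weighted-∷ true (all n) h ⟩
    ∑ elements (λ y → y ↑ α ⊗ weighted (all n) (λ s → h (y ⊕ s)))
      ≡⟨ ∑-cong elements (λ y → trans (cong (y ↑ α ⊗_) (weighted-all n (λ s → h (y ⊕ s)))) (trans (sym (∑-*ˡ (points F n) (y ↑ α) _))
           (∑-cong (points F n) (λ x → trans (sym (*-assoc _ _ _)) (cong (y ↑ α ⊗ mono (Vec.replicate n α) x ⊗_)
             (∑-cong elements (λ z → cong (λ s → z ↑ γ ⊗ h s) (sym (+-assoc y (total x) z))))))))) ⟩
    ∑ elements (λ y → ∑ (points F n) (λ x → y ↑ α ⊗ mono (Vec.replicate n α) x ⊗ ∑ elements (λ z → z ↑ γ ⊗ h (y ⊕ total x ⊕ z))))
      ≡⟨ ∑-points-∷ _ ⟨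
    ∑ (points F (suc n)) (λ x → mono (Vec.replicate (suc n) α) x ⊗ ∑ elements (λ z → z ↑ γ ⊗ h (total x ⊕ z))) ∎

  -- Shifting z by u and then using that y^(q-1) is the indicator of y ≠ 0.
  last-variable : ∀ u → ∑ elements (λ z → z ↑ γ ⊗ (u ⊕ z) ↑ (q ∸ 1)) ⊕ ⊖ u ↑ γ ≡ powerSum γ
  last-variable u = begin
    ∑ elements (λ z → z ↑ γ ⊗ (u ⊕ z) ↑ (q ∸ 1)) ⊕ ⊖ u ↑ γ
      ≡⟨ cong₂ _⊕_ (∑-cong elements (λ z → trans (*-comm _ _) (cong (λ s → (u ⊕ z) ↑ (q ∸ 1) ⊗ s ↑ γ) (unshift z))))
                   (cong (_↑ γ) (sym (+-identityʳ (⊖ u)))) ⟩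
    ∑ elements (λ z → (u ⊕ z) ↑ (q ∸ 1) ⊗ (⊖ u ⊕ (u ⊕ z)) ↑ γ) ⊕ (⊖ u ⊕ 𝟘) ↑ γ
      ≡⟨ cong (_⊕ (⊖ u ⊕ 𝟘) ↑ γ) (∑-shift u (λ y → y ↑ (q ∸ 1) ⊗ (⊖ u ⊕ y) ↑ γ)) ⟩
    ∑ elements (λ y → y ↑ (q ∸ 1) ⊗ (⊖ u ⊕ y) ↑ γ) ⊕ (⊖ u ⊕ 𝟘) ↑ γ
      ≡⟨ ∑-top (λ y → (⊖ u ⊕ y) ↑ γ) ⟩
    ∑ elements (λ y → (⊖ u ⊕ y) ↑ γ)
      ≡⟨ ∑-shift (⊖ u) (_↑ γ) ⟩
    powerSum γ ∎
    where
    unshift : ∀ z → z ≡ ⊖ u ⊕ (u ⊕ z)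
    unshift z = sym (trans (sym (+-assoc _ _ _)) (trans (cong (_⊕ z) (-‿inverseˡ u)) (+-identityˡ z)))

  total^β : ∀ {n} → Vec Carrier n → Carrier
  total^β x = total (Vec.map (_↑ β) x)

  total-frobenius : ∀ {n} (x : Vec Carrier n) → total x ↑ β ≡ total^β x
  total-frobenius []      = 𝟘-↑ 0<β
  total-frobenius (z ∷ x) = trans (frobenius^ k′ z (total x)) (cong (z ↑ β ⊕_) (total-frobenius x))

  -- By `total-frobenius` the second factor is (x_1 + ⋯ + x_l)^(βe). Written as a power of a sum of
  -- β-th powers, its expansion produces only exponents α + iβ.
  moment : ℕ → ℕ → Carrier
  moment l e = ∑ (points F l) (λ x → mono (Vec.replicate l α) x ⊗ total^β x ↑ e)

  momentTerm : (l e : ℕ) → Fin (suc e) → Carrier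
  momentTerm l e i = nat (e C toℕ i) ⊗ powerSum (α + toℕ i * β) ⊗ moment l (e ∸ toℕ i)

  moment-suc : ∀ l e → moment (suc l) e ≡ sum (momentTerm l e)
  moment-suc l e = begin
    moment (suc l) e
      ≡⟨ ∑-points-∷ _ ⟩
    ∑ elements (λ z → ∑ (points F l) (λ x → z ↑ α ⊗ M x ⊗ (z ↑ β ⊕ total^β x) ↑ e))
      ≡⟨ ∑-cong elements (λ z → ∑-cong (points F l) (λ x → expand z x)) ⟩
    ∑ elements (λ z → ∑ (points F l) (λ x → ∑ (List.allFin (suc e)) (λ i → c i ⊗ (z ↑ (α + toℕ i * β) ⊗ W i x))))
      ≡⟨ ∑-cong elements (λ z → ∑-comm (points F l) (List.allFin (suc e)) _) ⟩
    ∑ elements (λ z → ∑ (List.allFin (suc e)) (λ i → ∑ (points F l) (λ x → c i ⊗ (z ↑ (α + toℕ i * β) ⊗ W i x))))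
      ≡⟨ ∑-comm elements (List.allFin (suc e)) _ ⟩
    ∑ (List.allFin (suc e)) (λ i → ∑ elements (λ z → ∑ (points F l) (λ x → c i ⊗ (z ↑ (α + toℕ i * β) ⊗ W i x))))
      ≡⟨ ∑-cong (List.allFin (suc e)) (λ i → trans (∑-cong elements (λ z → ∑-*ˡ (points F l) (c i) _)) (trans (∑-*ˡ elements (c i) _)
           (trans (cong (c i ⊗_) (∑-product elements (points F l) (_↑ (α + toℕ i * β)) (W i))) (sym (*-assoc _ _ _))))) ⟩
    ∑ (List.allFin (suc e)) (momentTerm l e)
      ≡⟨ ∑-tabulate (suc e) id (momentTerm l e) ⟩
    sum (momentTerm l e) ∎
    where
    M : Vec Carrier l → Carrier
    M = mono (Vec.replicate l α)
    c : Fin (suc e) → Carrier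
    c i = nat (e C toℕ i)
    W : Fin (suc e) → Vec Carrier l → Carrier
    W i x = M x ⊗ total^β x ↑ (e ∸ toℕ i)
    term : ∀ z x i → z ↑ α ⊗ M x ⊗ binomialTerm e (z ↑ β) (total^β x) i ≡ c i ⊗ (z ↑ (α + toℕ i * β) ⊗ W i x)
    term z x i = trans (solve 5 (λ a m c b t → a :* m :* (c :* (b :* t)) := c :* (a :* b :* (m :* t))) refl
        (z ↑ α) (M x) (c i) ((z ↑ β) ↑ toℕ i) (total^β x ↑ (e ∸ toℕ i)))
      (cong (λ s → c i ⊗ (s ⊗ W i x)) (sym (trans (↑-+ z α (toℕ i * β)) (cong (z ↑ α ⊗_) (↑-* z β (toℕ i))))))
    expand : ∀ z x → z ↑ α ⊗ M x ⊗ (z ↑ β ⊕ total^β x) ↑ e ≡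
                     ∑ (List.allFin (suc e)) (λ i → c i ⊗ (z ↑ (α + toℕ i * β) ⊗ W i x))
    expand z x = trans (cong (z ↑ α ⊗ M x ⊗_) (trans (binomial e (z ↑ β) (total^β x)) (sym (∑-tabulate (suc e) id _))))
      (trans (sym (∑-*ˡ (List.allFin (suc e)) (z ↑ α ⊗ M x) _)) (∑-cong (List.allFin (suc e)) (term z x)))

  momentTerm-first : ∀ l e → momentTerm l e zero ≡ 𝟘
  momentTerm-first l e = trans (cong (λ s → nat (e C 0) ⊗ s ⊗ moment l e)
    (powerSum-small (subst (_< q ∸ 1) (sym (ℕ.+-identityʳ α)) α<q-1))) (trans (cong (_⊗ moment l e) (zeroʳ _)) (zeroˡ _))

  -- Each of the l variables must receive at least one factor x^β, since x^α alone sums to zero; e <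
  -- l factors do not suffice.
  moment-low : ∀ l e → e < l → moment l e ≡ 𝟘
  moment-low (suc l) e (s≤s e≤l) = trans (moment-suc l e) (sum-zero (momentTerm l e) λ
    { zero    → momentTerm-first l e
    ; (suc i) → trans (cong (nat (e C suc (toℕ i)) ⊗ powerSum (α + suc (toℕ i) * β) ⊗_)
        (moment-low l (e ∸ suc (toℕ i)) (ℕ.<-≤-trans (ℕ.∸-monoʳ-< (s≤s z≤n) (Fin.toℕ<n i)) e≤l))) (zeroʳ _) })

  -- With l factors for l variables each variable receives exactly one and turns into x^(q-1); the
  -- l! distributions give l! times the l-th power of `powerSum (q ∸ 1)`. A variable taking two or
  -- more would leave too few for the others, which is `higher`.
  moment-top : ∀ l → l < p → ¬ moment l l ≡ 𝟘
  moment-top zero    _   e = 0≢1 (sym (trans (sym (trans (∑-points-[] (λ x → mono [] x ⊗ total^β x ↑ 0)) (*-identityˡ 𝟙))) e))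
  moment-top (suc l) l<p e =
    *-nonzero (*-nonzero l+1≢0 powerSum-top≢0) (moment-top l (ℕ.<-trans (ℕ.n<1+n l) l<p)) (begin
      nat (suc l) ⊗ powerSum (q ∸ 1) ⊗ moment l l
        ≡⟨ cong₂ (λ c i → nat c ⊗ powerSum i ⊗ moment l l) (nC1≡n (suc l))
             (trans (cong (α +_) (ℕ.+-identityʳ β)) (trans (ℕ.+-comm α β) β+α≡q-1)) ⟨
      momentTerm l (suc l) (suc zero)
        ≡⟨ trans (cong₂ _⊕_ (momentTerm-first l (suc l)) (cong (momentTerm l (suc l) (suc zero) ⊕_) (sum-zero _ higher)))
                 (trans (+-identityˡ _) (+-identityʳ _)) ⟨
      sum (momentTerm l (suc l))
        ≡⟨ moment-suc l (suc l) ⟨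
      moment (suc l) (suc l)
        ≡⟨ e ⟩
      𝟘 ∎)
    where
    l+1≢0 : ¬ nat (suc l) ≡ 𝟘
    l+1≢0 l+1≡0 = nat-!-nonzero l<p (trans (nat-* (suc l) (l !)) (trans (cong (_⊗ nat (l !)) l+1≡0) (zeroˡ _)))
    higher : ∀ (i : Fin l) → momentTerm l (suc l) (suc (suc i)) ≡ 𝟘
    higher i = trans (cong (nat (suc l C suc (suc (toℕ i))) ⊗ powerSum (α + suc (suc (toℕ i)) * β) ⊗_)
      (moment-low l (l ∸ suc (toℕ i)) (ℕ.∸-monoʳ-< (s≤s z≤n) (Fin.toℕ<n i)))) (zeroʳ _)

  -- Summing `last-variable` against the weight `M` shows that the weighted sum equals -(-1)^γ times
  -- `moment p′ p′`, once the right-hand side is known to vanish.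
  weighted-all≢0 : ¬ weighted (all p′) (_↑ (q ∸ 1)) ≡ 𝟘
  weighted-all≢0 T≡0 = *-nonzero (↑-nonzero γ (⊖-nonzero (0≢1 ∘ sym))) (moment-top p′ (ℕ.n<1+n p′)) (begin
    ⊖ 𝟙 ↑ γ ⊗ moment p′ p′
      ≡⟨ ∑-*ˡ (points F p′) (⊖ 𝟙 ↑ γ) _ ⟨
    ∑ (points F p′) (λ x → ⊖ 𝟙 ↑ γ ⊗ (M x ⊗ total^β x ↑ p′))
      ≡⟨ ∑-cong (points F p′) sign-out ⟩
    ∑ (points F p′) (λ x → M x ⊗ ⊖ (total x) ↑ γ)
      ≡⟨ +-identityˡ _ ⟨
    𝟘 ⊕ ∑ (points F p′) (λ x → M x ⊗ ⊖ (total x) ↑ γ)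
      ≡⟨ cong (_⊕ ∑ (points F p′) (λ x → M x ⊗ ⊖ (total x) ↑ γ)) (trans (sym (weighted-all p′ (_↑ (q ∸ 1)))) T≡0) ⟨
    ∑ (points F p′) (λ x → M x ⊗ L x) ⊕ ∑ (points F p′) (λ x → M x ⊗ ⊖ (total x) ↑ γ)
      ≡⟨ ∑-+ (points F p′) _ _ ⟨
    ∑ (points F p′) (λ x → M x ⊗ L x ⊕ M x ⊗ ⊖ (total x) ↑ γ)
      ≡⟨ ∑-cong (points F p′) (λ x → trans (sym (distribˡ _ _ _)) (cong (M x ⊗_) (last-variable (total x)))) ⟩
    ∑ (points F p′) (λ x → M x ⊗ powerSum γ)
      ≡⟨ ∑-*ʳ (points F p′) (powerSum γ) M ⟩
    ∑ (points F p′) M ⊗ powerSum γ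
      -- The factor that vanishes is the sum of `M`. The other one can be nonzero: for q = p one has
      -- β = 1 and γ = q - 1.
      ≡⟨ trans (cong (_⊗ powerSum γ) (∑-mono-small (Vec.replicate p′ α) few)) (zeroˡ _) ⟩
    𝟘 ∎)
    where
    M : Vec Carrier p′ → Carrier
    M = mono (Vec.replicate p′ α)
    L : Vec Carrier p′ → Carrier
    L x = ∑ elements (λ z → z ↑ γ ⊗ (total x ⊕ z) ↑ (q ∸ 1))
    sum-replicate : ∀ n → Vec.sum (Vec.replicate n α) ≡ n * α
    sum-replicate zero    = refl
    sum-replicate (suc n) = cong (α +_) (sum-replicate n)
    few : Vec.sum (Vec.replicate p′ α) < p′ * (q ∸ 1)
    few = subst (_< p′ * (q ∸ 1)) (sym (sum-replicate p′)) (ℕ.*-monoʳ-< p′ {{>-nonZero 0<p′}} α<q-1)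
    sign-out : ∀ x → ⊖ 𝟙 ↑ γ ⊗ (M x ⊗ total^β x ↑ p′) ≡ M x ⊗ ⊖ (total x) ↑ γ
    sign-out x = begin
      ⊖ 𝟙 ↑ γ ⊗ (M x ⊗ total^β x ↑ p′)
        ≡⟨ solve 3 (λ s m t → s :* (m :* t) := m :* (s :* t)) refl (⊖ 𝟙 ↑ γ) (M x) (total^β x ↑ p′) ⟩
      M x ⊗ (⊖ 𝟙 ↑ γ ⊗ total^β x ↑ p′)
        ≡⟨ cong (λ s → M x ⊗ (⊖ 𝟙 ↑ γ ⊗ s)) (trans (↑-* (total x) β p′) (cong (_↑ p′) (total-frobenius x))) ⟨
      M x ⊗ (⊖ 𝟙 ↑ γ ⊗ total x ↑ γ)
        ≡⟨ cong (M x ⊗_) (trans (cong (_↑ γ) (sym (-1*x≈-x (total x)))) (*-↑ (⊖ 𝟙) (total x) γ)) ⟨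
      M x ⊗ ⊖ (total x) ↑ γ ∎

  sum-divExp : ∀ n → Vec.sum (divExp F n) ≡ n
  sum-divExp zero    = refl
  sum-divExp (suc n) = cong suc (sum-divExp n)

  module _ (P : Poly F p) (isP : IsP F p P) where
    P*divExp : ∀ x → mono (divExp F p′) x ⊗ eval F P x ≡ eval F (Qpoly F p′) x
    P*divExp x = begin
      mono (divExp F p′) x ⊗ eval F P x
        ≡⟨ cong (_⊗ eval F P x) (trans (+-identityʳ _) (*-identityˡ _)) ⟨
      eval F ((𝟙 , divExp F p′) ∷ []) x ⊗ eval F P x
        ≡⟨ mulPoly-eval ((𝟙 , divExp F p′) ∷ []) P x ⟨
      eval F (mulPoly F ((𝟙 , divExp F p′) ∷ []) P) x
        ≡⟨ ≐⇒⟪⟫ (mulPoly F ((𝟙 , divExp F p′) ∷ []) P) (Qpoly F p′) isP (λ a → mono a x) ⟩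
      eval F (Qpoly F p′) x ∎

    -- Nothing is divided: the monomial (x_1 ⋯ x_p)^γ contains the factor x_1 ⋯ x_(p-1), which turns
    -- P into the alternating sum `Qpoly`. Of its subsets I only the full one survives the
    -- summation.
    block≢0 : ¬ ∑ (points F p) (λ x → mono (Vec.replicate p γ) x ⊗ eval F P x) ≡ 𝟘
    block≢0 B≡0 = *-nonzero (↑-nonzero (∣ all p′ ∣ + 1) (⊖-nonzero (0≢1 ∘ sym))) weighted-all≢0 (begin
      sign (all p′) ⊗ weighted (all p′) (_↑ (q ∸ 1))
        ≡⟨ ∑-subsets p′ (λ I → sign I ⊗ weighted I (_↑ (q ∸ 1)))
             (λ I I≢ → trans (cong (sign I ⊗_) (weighted-proper I I≢ (_↑ (q ∸ 1)))) (zeroʳ _)) ⟨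
      ∑ (subsets p′) (λ I → sign I ⊗ weighted I (_↑ (q ∸ 1)))
        ≡⟨ ∑-cong (subsets p′) (λ I → sym (∑-*ˡ (points F p) (sign I) _)) ⟩
      ∑ (subsets p′) (λ I → ∑ (points F p) (λ x → sign I ⊗ (mono (weights p′) x ⊗ linear I x ↑ (q ∸ 1))))
        ≡⟨ ∑-comm (subsets p′) (points F p) _ ⟩
      ∑ (points F p) (λ x → ∑ (subsets p′) (λ I → sign I ⊗ (mono (weights p′) x ⊗ linear I x ↑ (q ∸ 1))))
        ≡⟨ ∑-cong (points F p) pointwise ⟩
      ∑ (points F p) (λ x → mono (Vec.replicate p γ) x ⊗ eval F P x)
        ≡⟨ B≡0 ⟩
      𝟘 ∎)
      where
      pointwise : ∀ x → ∑ (subsets p′) (λ I → sign I ⊗ (mono (weights p′) x ⊗ linear I x ↑ (q ∸ 1))) ≡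
                        mono (Vec.replicate p γ) x ⊗ eval F P x
      pointwise x = begin
        ∑ (subsets p′) (λ I → sign I ⊗ (mono (weights p′) x ⊗ linear I x ↑ (q ∸ 1)))
          ≡⟨ ∑-cong (subsets p′) (λ I → solve 3 (λ s m t → s :* (m :* t) := m :* (s :* t)) refl
               (sign I) (mono (weights p′) x) (linear I x ↑ (q ∸ 1))) ⟩
        ∑ (subsets p′) (λ I → mono (weights p′) x ⊗ (sign I ⊗ linear I x ↑ (q ∸ 1)))
          ≡⟨ ∑-*ˡ (subsets p′) (mono (weights p′) x) _ ⟩
        mono (weights p′) x ⊗ ∑ (subsets p′) (λ I → sign I ⊗ linear I x ↑ (q ∸ 1))
          ≡⟨ cong (mono (weights p′) x ⊗_) (trans (P*divExp x) (Qpoly-eval x)) ⟨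
        mono (weights p′) x ⊗ (mono (divExp F p′) x ⊗ eval F P x)
          ≡⟨ *-assoc _ _ _ ⟨
        mono (weights p′) x ⊗ mono (divExp F p′) x ⊗ eval F P x
          ≡⟨ cong (_⊗ eval F P x) (trans (cong (λ a → mono a x) (sym (divExp+weights p′))) (mono-+ (weights p′) (divExp F p′) x)) ⟨
        mono (Vec.replicate p γ) x ⊗ eval F P x ∎

    -- Multiplication by x_1 ⋯ x_(p-1) only translates exponents, so the coefficient of P at a is
    -- one of `Qpoly`, which is homogeneous of degree q - 1 = (q - p) + (p - 1).
    P-coeff : ∀ a → ¬ Vec.sum a ≡ q ∸ p → ⟪ P , indicator a ⟫ ≡ 𝟘
    P-coeff a a≢ = begin
      ⟪ P , indicator a ⟫
        ≡⟨ ∑-cong P (λ t → cong₂ _⊗_ (*-identityˡ (proj₁ t)) (indicator-shift (divExp F p′) a (proj₂ t))) ⟨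
      ∑ P (λ t → 𝟙 ⊗ proj₁ t ⊗ indicator a′ (Vec.zipWith _+_ (divExp F p′) (proj₂ t)))
        ≡⟨ trans (∑-++ (map _ P) [] _) (trans (+-identityʳ _) (∑-map _ P _)) ⟨
      ⟪ mulPoly F ((𝟙 , divExp F p′) ∷ []) P , indicator a′ ⟫
        ≡⟨ ≐⇒⟪⟫ (mulPoly F ((𝟙 , divExp F p′) ∷ []) P) (Qpoly F p′) isP (indicator a′) ⟩
      ⟪ Qpoly F p′ , indicator a′ ⟫
        ≡⟨ homogeneous-coeff Qpoly-homogeneous degree≢ ⟩
      𝟘 ∎
      where
      a′ = Vec.zipWith _+_ (divExp F p′) a
      degree≢ : ¬ Vec.sum a′ ≡ q ∸ 1
      degree≢ e = a≢ (begin
        Vec.sum a             ≡⟨ ℕ.m+n∸m≡n p′ (Vec.sum a) ⟨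
        p′ + Vec.sum a ∸ p′   ≡⟨ cong (λ s → s + Vec.sum a ∸ p′) (sum-divExp p′) ⟨
        Vec.sum (divExp F p′) + Vec.sum a ∸ p′   ≡⟨ cong (_∸ p′) (trans (sym (sum-zipWith-+ (divExp F p′) a)) e) ⟩
        q ∸ 1 ∸ p′            ≡⟨ ℕ.∸-+-assoc q 1 p′ ⟩
        q ∸ p                 ∎)

    -- The terms of P of degree other than q − p cancel.
    P-Low : Low (q ∸ p) (eval F P)
    P-Low = R , All.map ℕ.≤-reflexive (All.all-filter _ P) , λ x → ⟪⟫-filter degree? P P-coeff (λ a → mono a x)
      where
      degree? : ∀ a → Dec (Vec.sum a ≡ q ∸ p)
      degree? a = Vec.sum a ℕ.≟ q ∸ p
      R = filter (λ t → degree? (proj₂ t)) P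

-- Filling bins of equal capacity.

module Packing (c : ℕ) where
  -- The contents of B bins, the first with g units of space left and the others with capacity c,
  -- after S units have been poured in from the front.
  fill : (B g S : ℕ) → Vec ℕ B
  fill zero    g S = []
  fill (suc B) g S = g ⊓ S ∷ fill B c (S ∸ g)

  fill-full : ∀ a {B} S → fill (a + B) c (a * c + S) ≡ Vec.replicate a c Vec.++ fill B c S
  fill-full zero    S = refl
  fill-full (suc a) {B} S = cong₂ _∷_
    (trans (cong (c ⊓_) (ℕ.+-assoc c (a * c) S)) (ℕ.m≤n⇒m⊓n≡m (ℕ.m≤m+n c _)))
    (trans (cong (fill (a + B) c) (trans (cong (_∸ c) (ℕ.+-assoc c (a * c) S)) (ℕ.m+n∸m≡n c _))) (fill-full a S))

  fill-≤ : ∀ B S → VAll (_≤ c) (fill B c S)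
  fill-≤ zero    S = []
  fill-≤ (suc B) S = ℕ.m⊓n≤m c S ∷ fill-≤ B (S ∸ c)

  sum-fill : ∀ B S r → r ≤ S → r ≤ B * c → r ≤ Vec.sum (fill B c S)
  sum-fill zero    S r r≤S r≤0  = r≤0
  sum-fill (suc B) S r r≤S r≤Bc with ℕ.≤-total S c
  ... | inj₁ S≤c = ℕ.≤-trans r≤S (ℕ.≤-trans (ℕ.≤-reflexive (sym (ℕ.m≥n⇒m⊓n≡n S≤c))) (ℕ.m≤m+n _ _))
  ... | inj₂ c≤S = subst (λ z → r ≤ z + Vec.sum (fill B c (S ∸ c))) (sym (ℕ.m≤n⇒m⊓n≡m c≤S))
    (ℕ.≤-trans (ℕ.m≤n+m∸n r c) (ℕ.+-monoʳ-≤ c (sum-fill B (S ∸ c) (r ∸ c) (ℕ.∸-monoˡ-≤ c r≤S) (ℕ.m≤n+o⇒m∸n≤o r c r≤Bc))))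

-- The sparse flat test, in both directions.

module SparseFlatTest {q : ℕ} (F : FiniteField q) (p′ k′ : ℕ)
                      (p-prime : Prime (suc p′)) (q≡p^k : q ≡ suc p′ ^ suc k′)
                      (m t r : ℕ) (P : Poly F (suc p′)) (isP : IsP F (suc p′) P) where
  open Field F
  open Interpolation F
  open PowerSums F
  open Polynomials F
  open Characteristic F (suc p′) (suc k′) p-prime q≡p^k
  open TestPolynomial F p′ k′ p-prime q≡p^k
  open Packing γ

  k N : ℕ
  k = suc k′
  N = m * p + t

  1<p : 1 < p
  1<p = s≤s 0<p′

  γ+β≡q : γ + β ≡ q
  γ+β≡q = trans (ℕ.+-comm γ β) (sym q≡p^k)

  γ≤q-1 : γ ≤ q ∸ 1
  γ≤q-1 = subst₂ _≤_ (sym γ≡1+α) refl α<q-1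

  -- P has the degree p(β - 1) of (x_1 ⋯ x_p)^(β-1), the monomial complementary to (x_1 ⋯ x_p)^γ.
  -- Hence a block is exactly balanced, and the whole margin lies in r and the t last coordinates.
  pγ+[q-p]≡p[q-1] : p * γ + (q ∸ p) ≡ p * (q ∸ 1)
  pγ+[q-p]≡p[q-1] = begin
    p * γ + (q ∸ p)          ≡⟨ cong (λ z → p * γ + (z ∸ p)) q≡p^k ⟩
    p * γ + (p * β ∸ p)      ≡⟨ ℕ.+-∸-assoc (p * γ) (ℕ.m≤m*n p β {{>-nonZero 0<β}}) ⟨
    p * γ + p * β ∸ p        ≡⟨ cong₂ _∸_ (trans (sym (ℕ.*-distribˡ-+ p γ β)) (cong (p *_) γ+β≡q)) (sym (ℕ.*-identityʳ p)) ⟩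
    p * q ∸ p * 1            ≡⟨ ℕ.*-distribˡ-∸ p q 1 ⟨
    p * (q ∸ 1)              ∎
    where open ≡-Reasoning

  blocksP-++ : ∀ n y z → blocksP F p (suc n) P (y Vec.++ z) ≡ eval F P y ⊗ blocksP F p n P z
  blocksP-++ n y z with Vec.splitAt p (y Vec.++ z)
  ... | y′ , z′ , eq with Vec.++-injective y y′ eq
  ... | refl , refl = refl

  H-++ : ∀ e u w → H F p m t P e (u Vec.++ w) ≡ blocksP F p m P u ⊗ mono e w
  H-++ e u w with Vec.splitAt (m * p) (u Vec.++ w)
  ... | u′ , w′ , eq with Vec.++-injective u u′ eq
  ... | refl , refl = refl

  -- Affine forms on F^n

  Form : ℕ → Set
  Form n = Vec Carrier n × Carrier

  dot : ∀ {n} → Vec Carrier n → Vec Carrier n → Carrier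
  dot row z = sumF F (Vec.toList (Vec.zipWith _⊗_ row z))

  ⟦_⟧ : ∀ {n} → Form n → Vec Carrier n → Carrier
  ⟦ row , b ⟧ z = dot row z ⊕ b

  infixl 5 _at_
  _at_ : ∀ {n l} → Vec (Form n) l → Vec Carrier n → Vec Carrier l
  S at z = Vec.map (λ s → ⟦ s ⟧ z) S

  affine-at : ∀ {n l} (S : Vec (Form n) l) z → affine F (Vec.map proj₁ S) (Vec.map proj₂ S) z ≡ S at z
  affine-at []      z = refl
  affine-at (s ∷ S) z = cong (⟦ s ⟧ z ∷_) (affine-at S z)

  at-affine : ∀ {n l} (M : Vec (Vec Carrier n) l) b z → affine F M b z ≡ Vec.zip M b at z
  at-affine []      []      z = refl
  at-affine (_ ∷ M) (_ ∷ b) z = cong (_ ∷_) (at-affine M b z)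

  constant : ∀ {n} → Carrier → Form n
  constant {n} c = Vec.replicate n 𝟘 , c

  dot-0 : ∀ {n} (z : Vec Carrier n) → dot (Vec.replicate n 𝟘) z ≡ 𝟘
  dot-0 []      = refl
  dot-0 (y ∷ z) = trans (cong₂ _⊕_ (zeroˡ y) (dot-0 z)) (+-identityˡ 𝟘)

  constant-value : ∀ {n} c (z : Vec Carrier n) → ⟦ constant c ⟧ z ≡ c
  constant-value c z = trans (cong (_⊕ c) (dot-0 z)) (+-identityˡ c)

  combine : ∀ {n} → Form n → Carrier → Form n → Form n
  combine (row , b) μ (row′ , b′) = Vec.zipWith (λ x y → x ⊕ μ ⊗ y) row row′ , b ⊕ μ ⊗ b′

  dot-combine : ∀ {n} μ (row row′ z : Vec Carrier n) →
                dot (Vec.zipWith (λ x y → x ⊕ μ ⊗ y) row row′) z ≡ dot row z ⊕ μ ⊗ dot row′ z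
  dot-combine μ []        []         []      = solve 1 (λ c → con 0 := con 0 :+ c :* con 0) refl μ
  dot-combine μ (x ∷ row) (y ∷ row′) (w ∷ z) = trans (cong ((x ⊕ μ ⊗ y) ⊗ w ⊕_) (dot-combine μ row row′ z))
    (solve 6 (λ x y c w d e → (x :+ c :* y) :* w :+ (d :+ c :* e) := x :* w :+ d :+ c :* (y :* w :+ e)) refl
      x y μ w (dot row z) (dot row′ z))

  combine-value : ∀ {n} (σ : Form n) μ τ z → ⟦ combine σ μ τ ⟧ z ≡ ⟦ σ ⟧ z ⊕ μ ⊗ ⟦ τ ⟧ z
  combine-value (row , b) μ (row′ , b′) z = trans (cong (_⊕ (b ⊕ μ ⊗ b′)) (dot-combine μ row row′ z))
    (solve 5 (λ d e c b f → d :+ c :* e :+ (b :+ c :* f) := d :+ b :+ c :* (e :+ f)) refl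
      (dot row z) (dot row′ z) μ b b′)

  scaled : ∀ {n} → Carrier → Form n → Form n
  scaled μ = combine (constant 𝟘) μ

  scaled-value : ∀ {n} μ (σ : Form n) z → ⟦ scaled μ σ ⟧ z ≡ μ ⊗ ⟦ σ ⟧ z
  scaled-value μ σ z = trans (combine-value (constant 𝟘) μ σ z)
    (trans (cong (_⊕ μ ⊗ ⟦ σ ⟧ z) (constant-value 𝟘 z)) (+-identityˡ _))

  raise : ∀ {n} → Form n → Form (suc n)
  raise (row , b) = 𝟘 ∷ row , b

  raise-value : ∀ {n} (σ : Form n) y z → ⟦ raise σ ⟧ (y ∷ z) ≡ ⟦ σ ⟧ z
  raise-value (row , b) y z = cong (_⊕ b) (trans (cong (_⊕ dot row z) (zeroˡ y)) (+-identityˡ _))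

  coordinates : ∀ n → Vec (Form n) n
  coordinates zero    = []
  coordinates (suc n) = (𝟙 ∷ Vec.replicate n 𝟘 , 𝟘) ∷ Vec.map raise (coordinates n)

  coordinates-at : ∀ {n} (z : Vec Carrier n) → coordinates n at z ≡ z
  coordinates-at []      = refl
  coordinates-at {suc n} (y ∷ z) = cong₂ _∷_
    (trans (+-identityʳ _) (trans (cong₂ _⊕_ (*-identityˡ y) (dot-0 z)) (+-identityʳ y)))
    (trans (sym (Vec.map-∘ _ raise (coordinates n)))
      (trans (Vec.map-cong (λ σ → raise-value σ y z) (coordinates n)) (coordinates-at z)))

  -- Low degree functions pass

  Low-dot : ∀ {n} (row : Vec Carrier n) → Low 1 (dot row)
  Low-dot []        = Low-ext (λ { [] → refl }) (Low-weaken z≤n (Low-const 𝟘))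
  Low-dot (x ∷ row) = Low-ext (λ { (y ∷ z) → refl }) (Low-+
    (Low-++ {m = 1} {g = λ u → x ⊗ Vec.head u} {h = λ _ → 𝟙} {k = λ z → x ⊗ Vec.head z} (λ { (y ∷ []) w → sym (*-identityʳ _) })
      (Low-ext (λ { (y ∷ []) → cong (x ⊗_) (trans (*-identityʳ _) (*-identityʳ y)) }) (Low-* (Low-const x) (Low-mono (1 ∷ []))))
      (Low-const 𝟙))
    (Low-++ {m = 1} {g = λ _ → 𝟙} {k = λ z → dot row (Vec.tail z)} (λ { (y ∷ []) w → sym (*-identityˡ _) }) (Low-const 𝟙) (Low-dot row)))

  Low-Form : ∀ {n} (σ : Form n) → Low 1 ⟦ σ ⟧
  Low-Form (row , b) = Low-+ (Low-dot row) (Low-weaken z≤n (Low-const b))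

  Low-mono-at : ∀ {n l} (a : Vec ℕ l) (S : Vec (Form n) l) → Low (Vec.sum a) (λ z → mono a (S at z))
  Low-mono-at []      []      = Low-const 𝟙
  Low-mono-at (i ∷ a) (s ∷ S) = Low-*
    (Low-weaken (ℕ.≤-reflexive (ℕ.*-identityʳ i)) (Low-↑ (Low-Form s) i)) (Low-mono-at a S)

  Low-eval-at : ∀ {n l D} {R : Poly F l} → All (λ t → Vec.sum (proj₂ t) ≤ D) R →
                (S : Vec (Form n) l) → Low D (λ z → eval F R (S at z))
  Low-eval-at []       S = Low-weaken z≤n (Low-const 𝟘)
  Low-eval-at {R = (c , a) ∷ R} (le ∷ les) S =
    Low-+ (Low-weaken le (Low-* (Low-const c) (Low-mono-at a S))) (Low-eval-at les S)

  Low-blocksP : ∀ n → Low (n * (q ∸ p)) (blocksP F p n P)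
  Low-blocksP zero    = Low-const 𝟙
  Low-blocksP (suc n) = Low-++ (blocksP-++ n) (P-Low P isP) (Low-blocksP n)

  Low-H : ∀ e → Low (m * (q ∸ p) + Vec.sum e) (H F p m t P e)
  Low-H e = Low-++ (H-++ e) (Low-blocksP m) (Low-mono e)

  low-degree-passes : ∀ {n d} (f : Vec Carrier n → Carrier) → d + 1 ≡ m * p * γ + r →
                      DegreeAtMost F f d → PassesSparseFlatTest F p m t r P f
  low-degree-passes {n} {d} f d+1≡ (R , bounds , f≡) M b e (_ , e-small) = ∑-Low
    (Low-* (Low-ext (λ z → sym (trans (cong f (at-affine M b z)) (f≡ _)))
                    (Low-eval-at (All.map proj₂ bounds) (Vec.zip M b)))
           (Low-H e))
    (begin-strict
      -- The only strict step; it spends the 1 in d + 1.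
      d + (m * (q ∸ p) + Vec.sum e)                 <⟨ ℕ.≤-reflexive (cong (_+ (m * (q ∸ p) + Vec.sum e)) (ℕ.+-comm 1 d)) ⟩
      d + 1 + (m * (q ∸ p) + Vec.sum e)             ≡⟨ cong (_+ (m * (q ∸ p) + Vec.sum e)) d+1≡ ⟩
      m * p * γ + r + (m * (q ∸ p) + Vec.sum e)     ≡⟨ +-interchange (m * p * γ) r (m * (q ∸ p)) (Vec.sum e) ⟩
      m * p * γ + m * (q ∸ p) + (r + Vec.sum e)     ≡⟨ cong (_+ (r + Vec.sum e)) degrees ⟩
      m * p * (q ∸ 1) + (r + Vec.sum e)             ≤⟨ ℕ.+-monoʳ-≤ (m * p * (q ∸ 1)) (subst (_≤ t * (q ∸ 1)) (ℕ.+-comm (Vec.sum e) r) e-small) ⟩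
      m * p * (q ∸ 1) + t * (q ∸ 1)                 ≡⟨ ℕ.*-distribʳ-+ (q ∸ 1) (m * p) t ⟨
      N * (q ∸ 1)                                   ∎)
    where
    open ℕ.≤-Reasoning
    degrees : m * p * γ + m * (q ∸ p) ≡ m * p * (q ∸ 1)
    degrees = trans (cong (_+ m * (q ∸ p)) (ℕ.*-assoc m p γ)) (trans (sym (ℕ.*-distribˡ-+ m (p * γ) (q ∸ p)))
      (trans (cong (m *_) pγ+[q-p]≡p[q-1]) (sym (ℕ.*-assoc m p (q ∸ 1)))))

  -- Functions that pass have low degree

  Passes : (Vec Carrier N → Carrier) → Set
  Passes g = ∀ e → Valid F t r e → ⟨_,_⟩ F g (H F p m t P e) ≡ 𝟘

  Passes-subspace : Subspace Passes
  Passes-subspace = record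
    { ext   = λ g≡h pass e valid → trans (∑-cong (points F N) (λ z → cong (_⊗ H F p m t P e z) (sym (g≡h z)))) (pass e valid)
    ; null  = λ e valid → trans (∑-cong (points F N) (λ z → zeroˡ _)) (∑-zero (points F N))
    ; add   = λ pass-g pass-h e valid → trans (∑-cong (points F N) (λ z → distribʳ _ _ _))
                (trans (∑-+ (points F N) _ _) (trans (cong₂ _⊕_ (pass-g e valid) (pass-h e valid)) (+-identityˡ 𝟘)))
    ; scale = λ c pass e valid → trans (∑-cong (points F N) (λ z → *-assoc c _ _))
                (trans (∑-*ˡ (points F N) c _) (trans (cong (c ⊗_) (pass e valid)) (zeroʳ c)))
    }
  open Subspace Passes-subspace

  module _ (K Y T : Vec Carrier N → Carrier) where
    -- The coefficients in λ of K(Y + λT)^a. Only the first two are computed below; the second is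
    -- the formal derivative a·K·Y^(a-1)·T.
    powerCoeffs : ∀ a → Vec (Vec Carrier N → Carrier) (suc a)
    powerCoeffs zero    = K ∷ []
    powerCoeffs (suc a) = mulLinear Y T (λ _ → 𝟘) (powerCoeffs a)

    ev-powerCoeffs : ∀ a μ z → ev (powerCoeffs a) μ z ≡ K z ⊗ (Y z ⊕ μ ⊗ T z) ↑ a
    ev-powerCoeffs zero    μ z = solve 2 (λ k m → k :+ m :* con 0 := k :* con 1) refl (K z) μ
    ev-powerCoeffs (suc a) μ z = trans (ev-mulLinear Y T (λ _ → 𝟘) (powerCoeffs a) μ z)
      (trans (cong (λ s → 𝟘 ⊕ (Y z ⊕ μ ⊗ T z) ⊗ s) (ev-powerCoeffs a μ z))
        (solve 3 (λ k b s → con 0 :+ b :* (k :* s) := k :* (b :* s)) refl (K z) (Y z ⊕ μ ⊗ T z) ((Y z ⊕ μ ⊗ T z) ↑ a)))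

    head-mulLinear : ∀ {n} c (vs : Vec (Vec Carrier N → Carrier) (suc n)) z →
                     Vec.head (mulLinear Y T c vs) z ≡ c z ⊕ Y z ⊗ Vec.head vs z
    head-mulLinear c (v ∷ vs) z = refl

    second-mulLinear : ∀ {n} c (vs : Vec (Vec Carrier N → Carrier) (suc (suc n))) z →
                       Vec.head (Vec.tail (mulLinear Y T c vs)) z ≡ T z ⊗ Vec.head vs z ⊕ Y z ⊗ Vec.head (Vec.tail vs) z
    second-mulLinear c (v ∷ u ∷ vs) z = refl

    head-powerCoeffs : ∀ a z → Vec.head (powerCoeffs a) z ≡ K z ⊗ Y z ↑ a
    head-powerCoeffs zero    z = sym (*-identityʳ _)
    head-powerCoeffs (suc a) z = trans (head-mulLinear (λ _ → 𝟘) (powerCoeffs a) z)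
      (trans (cong (λ s → 𝟘 ⊕ Y z ⊗ s) (head-powerCoeffs a z))
        (solve 3 (λ k y s → con 0 :+ y :* (k :* s) := k :* (y :* s)) refl (K z) (Y z) (Y z ↑ a)))

    second-powerCoeffs : ∀ a z → Vec.head (Vec.tail (powerCoeffs (suc a))) z ≡ nat (suc a) ⊗ (K z ⊗ (Y z ↑ a ⊗ T z))
    second-powerCoeffs zero    z = solve 2 (λ t k → t :* k := (con 1 :+ con 0) :* (k :* (con 1 :* t))) refl (T z) (K z)
    second-powerCoeffs (suc a) z = trans (second-mulLinear (λ _ → 𝟘) (powerCoeffs (suc a)) z)
      (trans (cong₂ (λ s s′ → T z ⊗ s ⊕ Y z ⊗ s′) (head-powerCoeffs (suc a) z) (second-powerCoeffs a z))
        (solve 5 (λ t k y s n → t :* (k :* (y :* s)) :+ y :* ((con 1 :+ n) :* (k :* (s :* t)))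
                  := (con 1 :+ (con 1 :+ n)) :* (k :* (y :* s :* t))) refl (T z) (K z) (Y z) (Y z ↑ a) (nat a)))

  second∈ : ∀ {n} {V : (Vec Carrier N → Carrier) → Set} {vs : Vec _ (suc (suc n))} → VAll V vs → V (Vec.head (Vec.tail vs))
  second∈ (_ ∷ v ∷ _) = v

  -- Substituting σ + λτ for σ, the coefficient of λ^(p^u) in (σ + λτ)^((a+1) p^u) is (a+1) σ^(a p^u) τ^(p^u).
  split-power : ∀ K u a → ¬ p ∣ suc a → suc a < q →
                (∀ σ → Passes (λ z → K z ⊗ ⟦ σ ⟧ z ↑ (suc a * p ^ u))) →
                ∀ σ τ → Passes (λ z → K z ⊗ (⟦ σ ⟧ z ↑ (a * p ^ u) ⊗ ⟦ τ ⟧ z ↑ (p ^ u)))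
  split-power K u a ¬p∣ a< hyp σ τ = unscale (nat-nonzero ¬p∣) (ext
    (λ z → trans (second-powerCoeffs K Y T a z) (cong (λ s → nat (suc a) ⊗ (K z ⊗ (s ⊗ T z))) (sym (↑-* (⟦ σ ⟧ z) (p ^ u) a))))
    -- The polynomial is read in the variable λ^(p^u), in which its degree is only a + 1 < q. That
    -- variable still takes q distinct values, by injectivity of the Frobenius map.
    (second∈ (extract Passes-subspace (map (_↑ (p ^ u)) elements) (Unique.map⁺ (frobenius-injective u) unique)
      (subst (suc (suc a) ≤_) (sym (trans (List.length-map _ elements) size)) a<) (powerCoeffs K Y T (suc a)) values)))
    where
    Y T : Vec Carrier N → Carrier
    Y z = ⟦ σ ⟧ z ↑ (p ^ u)
    T z = ⟦ τ ⟧ z ↑ (p ^ u)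
    values : ∀ {μ} → μ ∈ map (_↑ (p ^ u)) elements → Passes (ev (powerCoeffs K Y T (suc a)) μ)
    values μ∈ with ∈-map⁻ (_↑ (p ^ u)) μ∈
    ... | ν , _ , refl = ext (λ z → sym (begin
      ev (powerCoeffs K Y T (suc a)) (ν ↑ (p ^ u)) z
        ≡⟨ ev-powerCoeffs K Y T (suc a) (ν ↑ (p ^ u)) z ⟩
      K z ⊗ (Y z ⊕ ν ↑ (p ^ u) ⊗ T z) ↑ suc a
        ≡⟨ cong (λ s → K z ⊗ s ↑ suc a) (trans (cong (_↑ (p ^ u)) (combine-value σ ν τ z))
             (trans (frobenius^ u _ _) (cong (Y z ⊕_) (*-↑ ν (⟦ τ ⟧ z) (p ^ u))))) ⟨
      K z ⊗ (⟦ combine σ ν τ ⟧ z ↑ (p ^ u)) ↑ suc a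
        ≡⟨ cong (K z ⊗_) (↑-* (⟦ combine σ ν τ ⟧ z) (p ^ u) (suc a)) ⟨
      K z ⊗ ⟦ combine σ ν τ ⟧ z ↑ (suc a * p ^ u) ∎)) (hyp (combine σ ν τ))
      where open ≡-Reasoning

  -- Splitting a power of a form into p^u-th powers of arbitrary forms, and packing these.

  Product : Set
  Product = List (Form N × ℕ)

  value : Product → Vec Carrier N → Carrier
  value []            z = 𝟙
  value ((σ , u) ∷ c) z = ⟦ σ ⟧ z ↑ (p ^ u) ⊗ value c z

  exponents : Product → List ℕ
  exponents = map proj₂

  weight : List ℕ → ℕ
  weight []       = 0
  weight (u ∷ us) = p ^ u + weight us

  weight-++ : ∀ us vs → weight (us ++ vs) ≡ weight us + weight vs
  weight-++ []       vs = refl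
  weight-++ (u ∷ us) vs = trans (cong (p ^ u +_) (weight-++ us vs)) (sym (ℕ.+-assoc (p ^ u) _ _))

  weight-↭ : ∀ {us vs} → us ↭ vs → weight us ≡ weight vs
  weight-↭ Perm.refl         = refl
  weight-↭ (prep u π)        = cong (p ^ u +_) (weight-↭ π)
  weight-↭ (swap {ys = us} u v π) = trans (cong (λ w → p ^ u + (p ^ v + w)) (weight-↭ π))
    (trans (sym (ℕ.+-assoc (p ^ u) _ _)) (trans (cong (_+ weight us) (ℕ.+-comm (p ^ u) (p ^ v))) (ℕ.+-assoc (p ^ v) _ _)))
  weight-↭ (Perm.trans π π′) = trans (weight-↭ π) (weight-↭ π′)

  value-↭ : ∀ {c c′} → c ↭ c′ → ∀ z → value c z ≡ value c′ z
  value-↭ Perm.refl                      z = refl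
  value-↭ (prep (σ , u) π)               z = cong (⟦ σ ⟧ z ↑ (p ^ u) ⊗_) (value-↭ π z)
  value-↭ (swap {ys = c} (σ , u) (τ , v) π) z = trans
    (cong (λ s → ⟦ σ ⟧ z ↑ (p ^ u) ⊗ (⟦ τ ⟧ z ↑ (p ^ v) ⊗ s)) (value-↭ π z))
    (solve 3 (λ a b s → a :* (b :* s) := b :* (a :* s)) refl (⟦ σ ⟧ z ↑ (p ^ u)) (⟦ τ ⟧ z ↑ (p ^ v)) (value c z))
  value-↭ (Perm.trans π π′)              z = trans (value-↭ π z) (value-↭ π′ z)

  value-++ : ∀ c c′ z → value (c ++ c′) z ≡ value c z ⊗ value c′ z
  value-++ []            c′ z = sym (*-identityˡ _)
  value-++ ((σ , u) ∷ c) c′ z = trans (cong (⟦ σ ⟧ z ↑ (p ^ u) ⊗_) (value-++ c c′ z)) (sym (*-assoc _ _ _))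

  exponents-++ : ∀ us {vs} c → exponents c ≡ us ++ vs →
                 ∃₂ λ c₁ c₂ → c ≡ c₁ ++ c₂ × exponents c₁ ≡ us × exponents c₂ ≡ vs
  exponents-++ []       c       e    = [] , c , refl , refl , e
  exponents-++ (u ∷ us) (s ∷ c) e with List.∷-injective e
  ... | refl , e′ with exponents-++ us c e′
  ... | c₁ , c₂ , refl , e₁ , e₂ = s ∷ c₁ , c₂ , refl , cong (u ∷_) e₁ , e₂

  p-part : ∀ a → 0 < a → ∃₂ λ u b → a ≡ suc b * p ^ u × ¬ p ∣ suc b
  p-part a = go a (<-wellFounded a)
    where
    go : ∀ a → Acc _<_ a → 0 < a → ∃₂ λ u b → a ≡ suc b * p ^ u × ¬ p ∣ suc b
    go (suc a) (acc rec) _ with p ∣? suc a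
    ... | no ¬p∣ = 0 , a , sym (ℕ.*-identityʳ (suc a)) , ¬p∣
    ... | yes (divides (suc b) e) with go (suc b) (rec (subst (suc b <_) (sym e) (ℕ.m<m*n (suc b) p 1<p))) (s≤s z≤n)
    ...   | u , c , e′ , ¬p∣ = suc u , c ,
      trans e (trans (cong (_* p) e′) (trans (ℕ.*-assoc (suc c) (p ^ u) p) (cong (suc c *_) (ℕ.*-comm (p ^ u) p)))) , ¬p∣

  -- The factor K is universally quantified so that it can absorb the powers split off before.
  SplitsInto : ℕ → List ℕ → Set
  SplitsInto a us = ∀ (K : Vec Carrier N → Carrier) → (∀ σ → Passes (λ z → K z ⊗ ⟦ σ ⟧ z ↑ a)) →
                    ∀ c → exponents c ≡ us → Passes (λ z → K z ⊗ value c z)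

  -- Each round takes one p^u off the lowest nonzero base p digit of a: writing a = (b + 1)p^u with
  -- b + 1 prime to p, the coefficient b + 1 produced by `split-power` is invertible. From a < q one
  -- gets u < k, which later makes p^u a divisor of γ.
  split : ∀ a → a < q → ∃ λ us → weight us ≡ a × All (_< k) us × SplitsInto a us
  split a = go a (<-wellFounded a)
    where
    go : ∀ a → Acc _<_ a → a < q → ∃ λ us → weight us ≡ a × All (_< k) us × SplitsInto a us
    go zero    _         _   = [] , refl , [] , λ { K hyp [] _ → hyp (constant 𝟘) }
    go (suc a) (acc rec) a<q with p-part (suc a) (s≤s z≤n)
    ... | u , b , e , ¬p∣ with go (b * p ^ u) (rec b<a) (ℕ.<-trans b<a a<q)
      where
      b<a : b * p ^ u < suc a
      b<a = subst (b * p ^ u <_) (sym e) (ℕ.m<n+m _ (ℕ.m^n>0 p u))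
    ...   | us , w≡ , us<k , splits = u ∷ us , trans (cong (p ^ u +_) w≡) (sym e) , u<k ∷ us<k , into
      where
      p^u≤1+a : p ^ u ≤ suc a
      p^u≤1+a = subst (p ^ u ≤_) (sym e) (ℕ.m≤m+n (p ^ u) (b * p ^ u))
      u<k : u < k
      u<k = ℕ.≰⇒> λ k≤u → ℕ.<⇒≱ (ℕ.≤-<-trans p^u≤1+a a<q) (subst (_≤ p ^ u) (sym q≡p^k) (ℕ.^-monoʳ-≤ p k≤u))
      1+b<q : suc b < q
      1+b<q = ℕ.≤-<-trans (subst (suc b ≤_) (sym e) (ℕ.m≤m*n (suc b) (p ^ u) {{>-nonZero (ℕ.m^n>0 p u)}})) a<q
      into : SplitsInto (suc a) (u ∷ us)
      into K hyp ((τ , v) ∷ c) ex with List.∷-injective ex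
      ... | refl , ex′ = ext (λ z → *-assoc _ _ _) (splits (λ z → K z ⊗ ⟦ τ ⟧ z ↑ (p ^ u))
        (λ σ → ext (λ z → solve 3 (λ k s t → k :* (s :* t) := k :* t :* s) refl (K z) (⟦ σ ⟧ z ↑ (b * p ^ u)) (⟦ τ ⟧ z ↑ (p ^ u)))
          (split-power K u b ¬p∣ 1+b<q (λ σ′ → subst (λ i → Passes (λ z → K z ⊗ ⟦ σ′ ⟧ z ↑ i)) e (hyp σ′)) σ τ)) c ex′)

  p^u∣p^v : ∀ {u v} → u ≤ v → p ^ u ∣ p ^ v
  p^u∣p^v {u} {v} u≤v = divides (p ^ (v ∸ u))
    (trans (cong (p ^_) (sym (ℕ.m∸n+n≡m u≤v))) (ℕ.^-distribˡ-+-* p (v ∸ u) u))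

  mono-fill-0 : ∀ B g (x : Vec Carrier B) → mono (fill B g 0) x ≡ 𝟙
  mono-fill-0 zero    g []      = refl
  mono-fill-0 (suc B) g (y ∷ x) = trans (cong₂ (λ i j → y ↑ i ⊗ mono (fill B γ j) x) (ℕ.⊓-zeroʳ g) (ℕ.0∸n≡0 g))
    (trans (*-identityˡ _) (mono-fill-0 B γ x))

  -- Powers of p in descending order fill the bins without gaps, since each divides the space left.
  pack : ∀ {B} (bins : Vec (Form N) B) g us → AllPairs _≥_ us → All (_< k) us → All (λ u → p ^ u ∣ g) us →
         ∃ λ c → exponents c ≡ us × (∀ z → value c z ≡ mono (fill B g (weight us)) (bins at z))
  pack {B} bins g [] _ _ _ = [] , refl , λ z → sym (mono-fill-0 B g (bins at z))
  -- When the bins are used up, every remaining form becomes the constant 1, so that surplus weight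
  -- leaves no trace in the value.
  pack [] g us@(_ ∷ _) _ _ _ = map (constant 𝟙 ,_) us , trans (sym (List.map-∘ us)) (List.map-id us) , λ z → ones us z
    where
    ones : ∀ us z → value (map (constant 𝟙 ,_) us) z ≡ 𝟙
    ones []       z = refl
    ones (u ∷ us) z = trans (cong₂ (λ s s′ → s ↑ (p ^ u) ⊗ s′) (constant-value 𝟙 z) (ones us z))
      (trans (*-identityʳ _) (𝟙-↑ (p ^ u)))
  -- The bin is full and the next one has γ = (p - 1)p^(k-1) units, a multiple of p^u for all u < k;
  -- the divisibility invariant is thereby restored.
  pack {suc B} (σ ∷ bins) zero us@(_ ∷ _) desc us<k _ with pack bins γ us desc us<k
    (All.map (λ u<k → ∣n⇒∣m*n p′ (p^u∣p^v (ℕ.≤-pred u<k))) us<k)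
  ... | c , ex , e = c , ex , λ z → trans (e z) (sym (*-identityˡ _))
  -- As p^u divides g > 0, it fits. The later exponents v are at most u, so p^v divides both g and
  -- p^u and hence the space that remains.
  pack {suc B} (σ ∷ bins) g@(suc _) (u ∷ us) (u≥ ∷ desc) (_ ∷ us<k) (u∣g ∷ us∣g)
    with pack (σ ∷ bins) (g ∸ p ^ u) us desc us<k (All.zipWith (λ {v} (v≤u , v∣g) →
      ∣m+n∣m⇒∣n (subst (p ^ v ∣_) (sym (ℕ.m+[n∸m]≡n (∣⇒≤ u∣g))) v∣g) (p^u∣p^v v≤u)) (u≥ , us∣g))
  ... | c , ex , e = (σ , u) ∷ c , cong (u ∷_) ex , λ z →
    trans (cong (⟦ σ ⟧ z ↑ (p ^ u) ⊗_) (e z)) (trans (sym (*-assoc _ _ _))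
      (cong₂ (λ s a → s ⊗ mono (fill B γ a) (bins at z))
        (trans (sym (↑-+ (⟦ σ ⟧ z) (p ^ u) _)) (cong (⟦ σ ⟧ z ↑_) first)) others))
    where
    g′ = g ∸ p ^ u
    g≡ : p ^ u + g′ ≡ g
    g≡ = ℕ.m+[n∸m]≡n (∣⇒≤ u∣g)
    first : p ^ u + (g′ ⊓ weight us) ≡ g ⊓ (p ^ u + weight us)
    first = trans (ℕ.+-distribˡ-⊓ (p ^ u) g′ (weight us)) (cong (_⊓ (p ^ u + weight us)) g≡)
    others : weight us ∸ g′ ≡ p ^ u + weight us ∸ g
    others = trans (sym (ℕ.[m+n]∸[m+o]≡n∸o (p ^ u) (weight us) g′)) (cong (p ^ u + weight us ∸_) g≡)

  -- Nonvanishing of the pairing of the packed monomial with H_e.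

  replicate-++ : ∀ a b (i : ℕ) → Vec.replicate (a + b) i ≡ Vec.replicate a i Vec.++ Vec.replicate b i
  replicate-++ zero    b i = refl
  replicate-++ (suc a) b i = cong (i ∷_) (replicate-++ a b i)

  blocks≢0 : ∀ n → ¬ ∑ (points F (n * p)) (λ u → mono (Vec.replicate (n * p) γ) u ⊗ blocksP F p n P u) ≡ 𝟘
  blocks≢0 zero    e = 0≢1 (sym (trans (sym (trans (∑-points-[] (λ u → mono [] u ⊗ 𝟙)) (*-identityˡ 𝟙))) e))
  blocks≢0 (suc n) e = *-nonzero (block≢0 P isP) (blocks≢0 n) (begin
    ∑ (points F p) g ⊗ ∑ (points F (n * p)) h
      ≡⟨ ∑-product (points F p) (points F (n * p)) g h ⟨
    ∑ (points F p) (λ y → ∑ (points F (n * p)) (λ z → g y ⊗ h z))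
      ≡⟨ ∑-cong (points F p) (λ y → ∑-cong (points F (n * p)) (λ z → factor y z)) ⟨
    ∑ (points F p) (λ y → ∑ (points F (n * p)) (λ z → G (y Vec.++ z)))
      ≡⟨ ∑-points-++ p G ⟨
    ∑ (points F (suc n * p)) G
      ≡⟨ e ⟩
    𝟘 ∎)
    where
    open ≡-Reasoning
    g : Vec Carrier p → Carrier
    g y = mono (Vec.replicate p γ) y ⊗ eval F P y
    h : Vec Carrier (n * p) → Carrier
    h z = mono (Vec.replicate (n * p) γ) z ⊗ blocksP F p n P z
    G : Vec Carrier (suc n * p) → Carrier
    G u = mono (Vec.replicate (suc n * p) γ) u ⊗ blocksP F p (suc n) P u
    factor : ∀ y z → G (y Vec.++ z) ≡ g y ⊗ h z
    factor y z = trans (cong₂ _⊗_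
        (trans (cong (λ a → mono a (y Vec.++ z)) (replicate-++ p (n * p) γ)) (mono-++ (Vec.replicate p γ) _ y z))
        (blocksP-++ n y z))
      (solve 4 (λ a b c d → a :* b :* (c :* d) := a :* c :* (b :* d)) refl
        (mono (Vec.replicate p γ) y) (mono (Vec.replicate (n * p) γ) z) (eval F P y) (blocksP F p n P z))

  complement : ∀ {n} → Vec ℕ n → Vec ℕ n
  complement = Vec.map (q ∸ 1 ∸_)

  complement-sum : ∀ {n} {b : Vec ℕ n} → VAll (_≤ γ) b → Vec.sum (complement b) + Vec.sum b ≡ n * (q ∸ 1)
  complement-sum []                         = refl
  complement-sum {b = i ∷ b} (i≤γ ∷ b≤γ) = trans (+-interchange (q ∸ 1 ∸ i) _ i _)
    (cong₂ _+_ (ℕ.m∸n+n≡m (ℕ.≤-trans i≤γ γ≤q-1)) (complement-sum b≤γ))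

  complement-≤ : ∀ {n} (b : Vec ℕ n) → All (_≤ q ∸ 1) (Vec.toList (complement b))
  complement-≤ []      = []
  complement-≤ (i ∷ b) = ℕ.m∸n≤m (q ∸ 1) i ∷ complement-≤ b

  complement-pairing : ∀ {n} {b : Vec ℕ n} → VAll (_≤ γ) b → ¬ ∑ (points F n) (λ w → mono b w ⊗ mono (complement b) w) ≡ 𝟘
  complement-pairing {n} {b} b≤γ e = top n (trans (sym (∑-cong (points F n) (λ w → pair b≤γ w))) e)
    where
    pair : ∀ {n} {b : Vec ℕ n} → VAll (_≤ γ) b → ∀ w → mono b w ⊗ mono (complement b) w ≡ mono (Vec.replicate n (q ∸ 1)) w
    pair []                      []      = *-identityˡ 𝟙
    pair {b = i ∷ b} (i≤γ ∷ b≤γ) (y ∷ w) = trans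
      (solve 4 (λ a b c d → a :* b :* (c :* d) := a :* c :* (b :* d)) refl (y ↑ i) (mono b w) (y ↑ (q ∸ 1 ∸ i)) (mono (complement b) w))
      (cong₂ _⊗_ (trans (sym (↑-+ y i (q ∸ 1 ∸ i))) (cong (y ↑_) (ℕ.m+[n∸m]≡n (ℕ.≤-trans i≤γ γ≤q-1)))) (pair b≤γ w))
    top : ∀ n → ¬ ∑ (points F n) (mono (Vec.replicate n (q ∸ 1))) ≡ 𝟘
    top zero    e = 0≢1 (sym (trans (sym (∑-points-[] (mono []))) e))
    top (suc n) e = *-nonzero powerSum-top≢0 (top n) (trans (sym (∑-mono-∷ (q ∸ 1) (Vec.replicate n (q ∸ 1)))) e)

  detected : ∀ {b : Vec ℕ t} → VAll (_≤ γ) b → r ≤ Vec.sum b → ¬ Passes (mono (Vec.replicate (m * p) γ Vec.++ b))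
  detected {b} b≤γ r≤ pass = *-nonzero (blocks≢0 m) (complement-pairing b≤γ) (begin
    ∑ (points F (m * p)) g ⊗ ∑ (points F t) h
      ≡⟨ ∑-product (points F (m * p)) (points F t) g h ⟨
    ∑ (points F (m * p)) (λ u → ∑ (points F t) (λ w → g u ⊗ h w))
      ≡⟨ ∑-cong (points F (m * p)) (λ u → ∑-cong (points F t) (λ w → factor u w)) ⟨
    ∑ (points F (m * p)) (λ u → ∑ (points F t) (λ w → G (u Vec.++ w)))
      ≡⟨ ∑-points-++ (m * p) G ⟨
    ∑ (points F N) G
      -- Since the entries of b and e add up to t(q - 1), validity of e amounts to r ≤ Σ b.
      ≡⟨ pass e (complement-≤ b , ℕ.≤-trans (ℕ.+-monoʳ-≤ (Vec.sum e) r≤) (ℕ.≤-reflexive (complement-sum b≤γ))) ⟩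
    𝟘 ∎)
    where
    open ≡-Reasoning
    e = complement b
    g : Vec Carrier (m * p) → Carrier
    g u = mono (Vec.replicate (m * p) γ) u ⊗ blocksP F p m P u
    h : Vec Carrier t → Carrier
    h w = mono b w ⊗ mono e w
    G : Vec Carrier N → Carrier
    G z = mono (Vec.replicate (m * p) γ Vec.++ b) z ⊗ H F p m t P e z
    factor : ∀ u w → G (u Vec.++ w) ≡ g u ⊗ h w
    factor u w = trans (cong₂ _⊗_ (mono-++ (Vec.replicate (m * p) γ) b u w) (H-++ e u w))
      (solve 4 (λ a b c d → a :* b :* (c :* d) := a :* c :* (b :* d)) refl
        (mono (Vec.replicate (m * p) γ) u) (mono b w) (blocksP F p m P u) (mono e w))

  open Sort (Flip.decTotalOrder ℕ.≤-decTotalOrder) using (sort; sort-↭; sort-↗)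

  -- The bins are the coordinate forms themselves. A product of weight at least mpγ + r fills the
  -- first mp of them and still leaves at least r for the last t, whose capacity tγ is sufficient;
  -- `detected` then contradicts passing.
  products-light : r ≤ t * γ → ∀ us → All (_< k) us → (∀ c → exponents c ≡ us → Passes (value c)) → weight us < m * p * γ + r
  products-light r≤tγ us us<k pass = ℕ.≰⇒> heavy
    where
    sorted<k : All (_< k) (sort us)
    sorted<k = All-resp-↭ (↭-sym (sort-↭ us)) us<k
    packed = pack (coordinates N) γ (sort us) (Linked⇒AllPairs (λ u≥v v≥w → ℕ.≤-trans v≥w u≥v) (sort-↗ us)) sorted<k
      (All.map (λ u<k → ∣n⇒∣m*n p′ (p^u∣p^v (ℕ.≤-pred u<k))) sorted<k)
    heavy : ¬ m * p * γ + r ≤ weight us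
    heavy heavy with packed
    -- Packing used the sorted exponents, but the hypothesis `pass` lists them as in `us`; the
    -- permutation is lifted from exponents to pairs of form and exponent.
    ... | c , ex , value≡ with ↭-map-inv proj₂ (subst (_↭ us) (sym ex) (sort-↭ us))
    ...   | c′ , us≡ , c↭c′ = detected (fill-≤ t S) (sum-fill t S r r≤S r≤tγ)
        (ext (λ z → trans (value-↭ (↭-sym c↭c′) z) (trans (value≡ z) (cong₂ mono filled (coordinates-at z)))) (pass c′ (sym us≡)))
      where
      S = weight us ∸ m * p * γ
      r≤S : r ≤ S
      r≤S = subst (_≤ S) (ℕ.m+n∸m≡n (m * p * γ) r) (ℕ.∸-monoˡ-≤ (m * p * γ) heavy)
      filled : fill N γ (weight (sort us)) ≡ Vec.replicate (m * p) γ Vec.++ fill t γ S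
      filled = trans (cong (fill N γ) (trans (weight-↭ (sort-↭ us)) (sym (ℕ.m+[n∸m]≡n (ℕ.≤-trans (ℕ.m≤m+n _ r) heavy)))))
                     (fill-full (m * p) S)

  -- Elimination of the variables of a passing function.

  module _ {d : ℕ} (d+1≡ : d + 1 ≡ m * p * γ + r) (r≤tγ : r ≤ t * γ) where
    -- The number s is the degree already spent on eliminated variables.
    Bounded : ∀ {n} → ℕ → Poly F n → Set
    Bounded s = All (λ (c , a) → All (_≤ q ∸ 1) (Vec.toList a) × s + Vec.sum a ≤ d)

    HasDegree : ∀ {n} → List ℕ → (Vec Carrier n → Carrier) → Set
    HasDegree {n} us f = ∃ λ (R : Poly F n) → Bounded (weight us) R × (∀ v → f v ≡ eval F R v)

    -- Quantifying over all lists S of forms makes the condition inheritable: the form put in for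
    -- the next variable can be scaled and replaced freely.
    AllPass : ∀ {n} → List ℕ → (Vec Carrier n → Carrier) → Set
    AllPass {n} us f = ∀ c → exponents c ≡ us → (S : Vec (Form N) n) → Passes (λ z → value c z ⊗ f (S at z))

    module _ {n} (S : Vec (Form N) n) (σ : Form N) where
      -- The coefficients in μ after μσ has been substituted for the first variable of f; K collects
      -- the powers of σ.
      twist : ∀ {l} → (Vec Carrier N → Carrier) → Vec (Vec Carrier n → Carrier) l → Vec (Vec Carrier N → Carrier) l
      twist K []       = []
      twist K (v ∷ vs) = (λ z → K z ⊗ v (S at z)) ∷ twist (λ z → K z ⊗ ⟦ σ ⟧ z) vs

      ev-twist : ∀ {l} K (vs : Vec (Vec Carrier n → Carrier) l) μ z →
                 ev (twist K vs) μ z ≡ K z ⊗ ev vs (μ ⊗ ⟦ σ ⟧ z) (S at z)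
      ev-twist K []       μ z = sym (zeroʳ _)
      ev-twist K (v ∷ vs) μ z = trans (cong (λ s → K z ⊗ v (S at z) ⊕ μ ⊗ s) (ev-twist (λ z → K z ⊗ ⟦ σ ⟧ z) vs μ z))
        (solve 5 (λ k v c s e → k :* v :+ c :* (k :* s :* e) := k :* (v :+ c :* s :* e)) refl
          (K z) (v (S at z)) μ (⟦ σ ⟧ z) (ev vs (μ ⊗ ⟦ σ ⟧ z) (S at z)))

      twist-cong : ∀ {l K K′} → (∀ z → K z ≡ K′ z) → (vs : Vec (Vec Carrier n → Carrier) l) →
                   VAll Passes (twist K vs) → VAll Passes (twist K′ vs)
      twist-cong K≡K′ []       []         = []
      twist-cong K≡K′ (v ∷ vs) (v∈ ∷ vs∈) = ext (λ z → cong (_⊗ v (S at z)) (K≡K′ z)) v∈ ∷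
        twist-cong (λ z → cong (_⊗ ⟦ σ ⟧ z) (K≡K′ z)) vs vs∈

    -- Recursion over the variables. The coefficient w of x^j passes when multiplied by σ^j for
    -- every form σ; splitting σ^j moves the degree j into the list `us`, so w is a function of
    -- fewer variables with the same property. At the end f is a constant: if it is zero it
    -- contributes no term, and otherwise it can be cancelled, so that `products-light` bounds the
    -- weight, which by then is the degree of the monomial reached.
    degree : ∀ {n} us → All (_< k) us → (f : Vec Carrier n → Carrier) → AllPass us f → HasDegree us f
    degree {zero} us us<k f pass with f [] ≟ 𝟘
    ... | yes f≡0 = [] , [] , λ { [] → f≡0 }
    ... | no  f≢0 = (f [] , []) ∷ [] , ([] , light) ∷ [] , λ { [] → sym (trans (+-identityʳ _) (*-identityʳ _)) }
      where
      light : weight us + 0 ≤ d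
      light = subst (_≤ d) (sym (ℕ.+-identityʳ _)) (ℕ.≤-pred (subst (weight us <_) (trans (sym d+1≡) (ℕ.+-comm d 1))
        (products-light r≤tγ us us<k (λ c ex → unscale f≢0 (ext (λ z → *-comm _ _) (pass c ex []))))))
    degree {suc n} us us<k f pass with interpolate elements unique (λ x v → f (x ∷ v))
    ... | vs , f≡ = proj₁ poly , proj₁ (proj₂ poly) , λ { (x ∷ v) → trans (f≡ (complete x) v) (trans (sym (*-identityˡ _)) (proj₂ (proj₂ poly) x v)) }
      where
      room : ∀ j l → j + suc l ≤ q → j < q × suc j + l ≤ q
      room j l le = ℕ.≤-trans (ℕ.m≤m+n (suc j) l) le′ , le′
        where
        le′ : suc j + l ≤ q
        le′ = subst (_≤ q) (ℕ.+-suc j l) le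
      -- The vector `ws` holds the coefficients of x^j, x^(j+1), ... still to be treated. The bound
      -- j + l ≤ q gives j < q for each of them, as required both by `split` and by the individual
      -- degree.
      coefficients : ∀ {l} j (ws : Vec (Vec Carrier n → Carrier) l) → j + l ≤ q →
        (∀ c → exponents c ≡ us → ∀ S σ → VAll Passes (twist S σ (λ z → value c z ⊗ ⟦ σ ⟧ z ↑ j) ws)) →
        ∃ λ (R : Poly F (suc n)) → Bounded (weight us) R × (∀ x v → x ↑ j ⊗ ev ws x v ≡ eval F R (x ∷ v))
      coefficients j [] _ _ = [] , [] , λ x v → zeroʳ _
      coefficients {suc l} j (w ∷ ws) j+l<q hyp with split j (proj₁ (room j l j+l<q))
      ... | us′ , weight≡ , us′<k , splits = R , All.++⁺ (All.map⁺ (All.map (λ {s} → bound {s}) (proj₁ (proj₂ lowest)))) (proj₁ (proj₂ higher)) , λ x v → sym (begin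
        eval F R (x ∷ v)
          ≡⟨ ∑-++ (map raiseTerm (proj₁ lowest)) (proj₁ higher) _ ⟩
        ∑ (map raiseTerm (proj₁ lowest)) (λ s → proj₁ s ⊗ mono (proj₂ s) (x ∷ v)) ⊕ eval F (proj₁ higher) (x ∷ v)
          ≡⟨ cong (_⊕ eval F (proj₁ higher) (x ∷ v)) (trans (∑-map raiseTerm (proj₁ lowest) _)
               (trans (∑-cong (proj₁ lowest) (λ s → solve 3 (λ c y a → c :* (y :* a) := y :* (c :* a)) refl (proj₁ s) (x ↑ j) (mono (proj₂ s) v)))
                      (∑-*ˡ (proj₁ lowest) (x ↑ j) _))) ⟩
        x ↑ j ⊗ eval F (proj₁ lowest) v ⊕ eval F (proj₁ higher) (x ∷ v)
          ≡⟨ cong₂ (λ a b → x ↑ j ⊗ a ⊕ b) (proj₂ (proj₂ lowest) v) (proj₂ (proj₂ higher) x v) ⟨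
        x ↑ j ⊗ w v ⊕ x ⊗ x ↑ j ⊗ ev ws x v
          ≡⟨ solve 4 (λ y a x e → y :* a :+ x :* y :* e := y :* (a :+ x :* e)) refl (x ↑ j) (w v) x (ev ws x v) ⟩
        x ↑ j ⊗ (w v ⊕ x ⊗ ev ws x v) ∎)
        where
        open ≡-Reasoning
        raiseTerm : Carrier × Vec ℕ n → Carrier × Vec ℕ (suc n)
        raiseTerm (c , a) = c , j ∷ a
        higher = coefficients (suc j) ws (proj₂ (room j l j+l<q)) λ c ex S σ →
          twist-cong S σ (λ z → solve 3 (λ a s y → a :* y :* s := a :* (s :* y)) refl (value c z) (⟦ σ ⟧ z) (⟦ σ ⟧ z ↑ j)) ws (VAll.tail (hyp c ex S σ))
        pass-w : AllPass (us′ ++ us) w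
        pass-w c ex S with exponents-++ us′ c ex
        ... | c₁ , c₂ , refl , ex₁ , ex₂ = ext
          (λ z → trans (solve 3 (λ a b s → a :* s :* b := b :* a :* s) refl (value c₂ z) (value c₁ z) (w (S at z)))
                       (cong (_⊗ w (S at z)) (sym (value-++ c₁ c₂ z))))
          (splits (λ z → value c₂ z ⊗ w (S at z))
            (λ σ → ext (λ z → solve 3 (λ a y s → a :* y :* s := a :* s :* y) refl (value c₂ z) (⟦ σ ⟧ z ↑ j) (w (S at z)))
                       (VAll.head (hyp c₂ ex₂ S σ))) c₁ ex₁)
        lowest = degree (us′ ++ us) (All.++⁺ us′<k us<k) w pass-w
        R = map raiseTerm (proj₁ lowest) ++ proj₁ higher
        bound : ∀ {s : Carrier × Vec ℕ n} →
          All (_≤ q ∸ 1) (Vec.toList (proj₂ s)) × weight (us′ ++ us) + Vec.sum (proj₂ s) ≤ d →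
          All (_≤ q ∸ 1) (j ∷ Vec.toList (proj₂ s)) × weight us + (j + Vec.sum (proj₂ s)) ≤ d
        bound {_ , a} (small , le) =
          ℕ.≤-pred (subst (suc j ≤_) q≡1+[q-1] (proj₁ (room j l j+l<q))) ∷ small ,
          subst (_≤ d) (trans (cong (_+ Vec.sum a) (trans (weight-++ us′ us) (trans (ℕ.+-comm (weight us′) _) (cong (weight us +_) weight≡))))
                              (ℕ.+-assoc (weight us) j _)) le
      poly = coefficients 0 vs (ℕ.≤-reflexive size) λ c ex S σ →
        -- With μσ in place of the first form and μ running through the field there are q values for
        -- q coefficients.
        extract Passes-subspace elements unique ℕ.≤-refl (twist S σ (λ z → value c z ⊗ 𝟙) vs) λ {μ} _ →
          ext (λ z → trans (cong₂ (λ a b → a ⊗ f (b ∷ (S at z))) (sym (*-identityʳ _)) (scaled-value μ σ z))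
                (trans (cong (value c z ⊗ 𝟙 ⊗_) (f≡ (complete _) (S at z))) (sym (ev-twist S σ (λ z → value c z ⊗ 𝟙) vs μ z))))
            (pass c ex (scaled μ σ ∷ S))

    passing-has-low-degree : ∀ {n} (f : Vec Carrier n → Carrier) →
                             PassesSparseFlatTest F p m t r P f → DegreeAtMost F f d
    passing-has-low-degree f pass = degree [] [] f λ { [] _ S → ext
      (λ z → trans (cong f (affine-at S z)) (sym (*-identityˡ _))) (pass (Vec.map proj₁ S) (Vec.map proj₂ S)) }

theorem3p4 : ∀ (p k q n d m r : ℕ) → Prime p → 1 ≤ k → q ≡ p ^ k →
    (F : FiniteField q) →
    1 ≤ n → 1 ≤ d →
    d + 1 ≡ (m * p) * (q ∸ p ^ (k ∸ 1)) + r →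
    0 < r → r ≤ p * (q ∸ p ^ (k ∸ 1)) →
    (P : Poly F p) → IsP F p P →
    (f : Vec (FiniteField.Carrier F) n → FiniteField.Carrier F) →
    PassesSparseFlatTest F p m ((p + 2) ⊔ 10) r P f ⇔ DegreeAtMost F f d
theorem3p4 zero _ _ _ _ _ _ _ _ _ _ _ _ _ _ _ _ ()
theorem3p4 (suc p′) zero _ _ _ _ _ _ ()
theorem3p4 p@(suc p′) (suc k′) q n d m r p-prime _ q≡p^k F _ _ d+1≡ _ r≤ P isP f =
  mk⇔ (passing-has-low-degree d+1≡mpγ+r r≤tγ f) (low-degree-passes f d+1≡mpγ+r)
  where
  open TestPolynomial F p′ k′ p-prime q≡p^k using (β; γ)
  open SparseFlatTest F p′ k′ p-prime q≡p^k m ((p + 2) ⊔ 10) r P isP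
  q-β≡γ : q ∸ p ^ k′ ≡ γ
  q-β≡γ = trans (cong (_∸ p ^ k′) q≡p^k) (ℕ.m+n∸m≡n β γ)
  d+1≡mpγ+r : d + 1 ≡ m * p * γ + r
  d+1≡mpγ+r = trans d+1≡ (cong (λ c → m * p * c + r) q-β≡γ)
  -- From r ≤ pγ and t ≥ p: the t last coordinates have room for r.
  r≤tγ : r ≤ ((p + 2) ⊔ 10) * γ
  r≤tγ = ℕ.≤-trans (subst (λ c → r ≤ p * c) q-β≡γ r≤)
                   (ℕ.*-monoˡ-≤ γ (ℕ.≤-trans (ℕ.m≤m+n p 2) (ℕ.m≤m⊔n (p + 2) 10)))
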